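{- For every $n \geq 0$ and every rooted planar map $M$ with $n$ edges, $\rho(M) = \rho'(M)$.
   Context: A rooted planar map has a marked root corner on the outer face, whose vertex is the root vertex; the root edge is the edge next to the root corner in clockwise order; the empty map is a single vertex. $\operatorname{outv}(M)$ is the number of vertices incident to the outer face. A one-corner component is a rooted planar map whose root corner is the only corner of the root vertex on the outer face; $\operatorname{outv}_{\mathcal{U}}(U)$ is the number of outer-face vertices of $U$ other than the root vertex. For a non-empty one-corner component $U$ with root edge $e$, $\Pi(U)$ is obtained by deleting $e$ and re-rooting at the corner from which the other end of $e$ stems. Recursive map $\rho$ (to labeled plane trees): $\rho$(empty map) is a single node labeled $1$. If $M$ has at least one edge, with root vertex $v_M$, cut $M$ at each corner of $v_M$ incident to the outer face (duplicating $v_M$), obtaining one-corner components $U_1,\ldots,U_k$ (each rooted at its copy of $v_M$), listed counter-clockwise starting from the root corner; let $M_i = \Pi(U_i)$. Then $\rho(M)$ has a root labeled $\operatorname{outv}(M)$ whose children, from left to right, are the roots of copies of $\rho(M_1),\ldots,\rho(M_k)$, where all labels are kept except that the root of the copy of $\rho(M_i)$ is relabeled $\operatorname{outv}_{\mathcal{U}}(U_i)$. Direct map $\rho'$: label the root vertex of $M$ by $\operatorname{outv}(M)$, and perform a clockwise contour walk from the root corner. Traversing an already visited edge does nothing. When at a corner $c$ about to traverse a new edge $e$ from $v$ to $w$: let $c_1$ be the corner of $v$ on the other side of $e$, and $c_2$ the next corner of $v$ in clockwise direction that is incident to the outer face; the part of the map between $c$ and $c_2$ is a one-corner component $U$, and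 $w$ receives label $\operatorname{outv}_{\mathcal{U}}(U)$. If $c_1 = c_2$ ($e$ is a bridge), do nothing more; if $c_1 \neq c_2$, detach the part of the map between $c_1$ and $c_2$ at $v$, duplicating $v$. At the end of the walk the map is a vertex-labeled plane tree rooted at the original root corner, denoted $\rho'(M)$. -}

module Defs where

open import Data.Bool using (Bool; true; false; not; if_then_else_)
import Data.Bool.Properties as Bool
open import Data.Fin using (Fin)
import Data.Fin.Properties as Fin
open import Data.List
  using (List; []; _∷_; length; map; filter; reverse; iterate; takeWhile;
         deduplicate; head; drop; cartesianProduct; allFin)
import Data.List.Membership.DecPropositional as DecMembership
open import Data.List.Membership.Propositional using (_∈_)
open import Data.Maybe using (Maybe; just; nothing; fromMaybe)
open import Data.Nat using (ℕ; zero; suc; _+_; _*_)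
open import Data.Product using (_×_; _,_; proj₁)
open import Data.Product.Properties using (≡-dec)
open import Data.Sum using (_⊎_)
open import Function using (_∘_; const)
open import Function.Bundles using (_↔_; Inverse)
open import Relation.Binary.Construct.Closure.ReflexiveTransitive using (Star)
open import Relation.Binary.Definitions using (DecidableEquality)
open import Relation.Binary.PropositionalEquality using (_≡_)
open import Relation.Nullary using (Dec; does)
open import Relation.Nullary.Decidable using (¬?)

-- Labels count vertices; children are listed from left to right.
data Tree : Set where
  node : ℕ → List Tree → Tree

relabel : ℕ → Tree → Tree
relabel a (node _ ts) = node a ts

-- The two darts of an edge are its two half-edges; the dart d stems from a
-- vertex and points to the vertex of α d.
Dart : ℕ → Set
Dart n = Fin n × Bool

edge : ∀ {n} → Dart n → Fin n
edge = proj₁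

α : ∀ {n} → Dart n → Dart n
α (e , b) = e , not b

_≟_ : ∀ {n} → DecidableEquality (Dart n)
_≟_ = ≡-dec Fin._≟_ Bool._≟_

module _ {n : ℕ} where
  open DecMembership (_≟_ {n}) public using (_∈?_)

module _ {n : ℕ} where
  open DecMembership (Fin._≟_ {n}) public using () renaming (_∈?_ to _∈ᵉ?_)

darts : ∀ n → List (Dart n)
darts n = cartesianProduct (allFin n) (false ∷ true ∷ [])

-- σ d is the dart following d in clockwise order around the vertex of d.
-- A corner is represented by the dart following it in clockwise order, so that
-- "the corner d" lies between the predecessor of d and d.
Rotation : ℕ → Set
Rotation n = Dart n → Dart n

-- The cycle of a permutation f through x, listed from x.
orbit : ∀ {n} → (Dart n → Dart n) → Dart n → List (Dart n)
orbit {n} f x = x ∷ takeWhile (λ y → ¬? (y ≟ x)) (iterate f (f x) (n * 2))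

-- Leaving the corner d along the dart d keeps the face of this corner on the
-- left, and leads to the corner following α d in clockwise order.  For the
-- outer face this is the clockwise contour walk.
next : ∀ {n} → Rotation n → Dart n → Dart n
next σ d = σ (α d)

face : ∀ {n} → Rotation n → Dart n → List (Dart n)
face σ = orbit (next σ)

SameVertex SameFace : ∀ {n} → Rotation n → Dart n → Dart n → Set
SameVertex σ x y = y ∈ orbit σ x
SameFace   σ x y = y ∈ face σ x

sameVertex? : ∀ {n} (σ : Rotation n) x y → Dec (SameVertex σ x y)
sameVertex? σ x y = y ∈? orbit σ x

sameFace? : ∀ {n} (σ : Rotation n) x y → Dec (SameFace σ x y)
sameFace? σ x y = y ∈? face σ x

#vertices #faces : ∀ {n} → Rotation n → ℕ
#vertices {n} σ = length (deduplicate (sameVertex? σ) (darts n))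
#faces    {n} σ = length (deduplicate (sameFace? σ) (darts n))

Connected : ∀ {n} → Rotation n → Set
Connected σ = ∀ x y → Star (λ u v → v ≡ σ u ⊎ v ≡ α u) x y

-- A map with n edges is a permutation of the darts on which σ and α act
-- transitively; it is planar when it has genus 0.  The root corner determines
-- the outer face.  The vertex map has no dart and is treated apart.
data RootedPlanarMap : ℕ → Set where
  vertexMap : RootedPlanarMap 0
  planarMap : ∀ {n} (σ : Dart n ↔ Dart n) (root : Dart n) →
              Connected (Inverse.to σ) →
              #vertices (Inverse.to σ) + #faces (Inverse.to σ) ≡ n + 2 →
              RootedPlanarMap n

-- Cutting and deleting yield several maps on a common set of darts.  A rotation
-- with a root stands for the connected component of its root: the darts outside
-- of this component are not part of the map.  The root `nothing` stands for
-- the map reduced to a vertex.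
record Rooted (n : ℕ) : Set where
  constructor rooted
  field
    rotation : Rotation n
    root     : Maybe (Dart n)

underlying : ∀ {n} → RootedPlanarMap n → Rooted n
underlying vertexMap              = rooted (λ d → d) nothing
underlying (planarMap σ root _ _) = rooted (Inverse.to σ) (just root)

outerVertices : ∀ {n} → Rotation n → Dart n → List (Dart n)
outerVertices σ c = deduplicate (sameVertex? σ) (face σ c)

outv : ∀ {n} → Rooted n → ℕ
outv (rooted σ nothing)  = 1
outv (rooted σ (just c)) = length (outerVertices σ c)

outvᵤ : ∀ {n} → Rotation n → Dart n → ℕ
outvᵤ σ c = length (filter (λ x → ¬? (sameVertex? σ c x)) (outerVertices σ c))

swap : ∀ {n} → Dart n → Dart n → Dart n → Dart n
swap a b x = if does (x ≟ a) then b else if does (x ≟ b) then a else x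

-- For corners a and b of the same vertex, the darts from a (included) clockwise
-- to b (excluded) become a vertex of their own.  If a and b are the same
-- corner, the rotation does not change.
detach : ∀ {n} → Dart n → Dart n → Rotation n → Rotation n
detach a b σ = swap a b ∘ σ

-- The corners of the root vertex incident to the outer face, clockwise from the
-- root corner.
outerCorners : ∀ {n} → Rotation n → Dart n → List (Dart n)
outerCorners σ c = filter (_∈? face σ c) (orbit σ c)

-- Cuts a vertex at all the given corners, listed in clockwise order.
cut : ∀ {n} → List (Dart n) → Rotation n → Rotation n
cut []           σ = σ
cut (a ∷ [])     σ = σ
cut (a ∷ b ∷ cs) σ = cut (b ∷ cs) (detach a b σ)

-- The dart becomes alone around a vertex of its own.
isolate : ∀ {n} → Dart n → Rotation n → Rotation n
isolate d σ = detach d (σ d) σ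

-- Deletion of the root edge, both darts of which become alone around their
-- vertex, hence leave the component of any other dart.  The new root corner is
-- the one which contained α c; if α c was the only remaining dart around its
-- vertex, the map is reduced to this vertex.
Π : ∀ {n} → Rotation n → Dart n → Rooted n
Π σ c = rooted (isolate (α c) σ′) (if does (r ≟ α c) then nothing else just r)
  where
  σ′ = isolate c σ
  r  = σ′ (α c)

-- ρ-rec k is the recursion for maps with at most k edges; Π deletes an edge.
ρ-rec : ∀ {n} → ℕ → Rooted n → Tree
ρ-rec zero    M                   = node 1 []
ρ-rec (suc k) (rooted σ nothing)  = node 1 []
ρ-rec (suc k) (rooted σ (just c)) =
  node (outv (rooted σ (just c)))
       (map (λ cᵢ → relabel (outvᵤ σ′ cᵢ) (ρ-rec k (Π σ′ cᵢ)))
            (reverse (outerCorners σ c)))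
  where σ′ = cut (outerCorners σ c) σ

ρ : ∀ {n} → RootedPlanarMap n → Tree
ρ {n} M = ρ-rec n (underlying M)

-- `label d` is the label of the vertex of d; when a vertex is duplicated, both
-- copies keep its label.
record State (n : ℕ) : Set where
  field
    rotation : Rotation n
    label    : Dart n → ℕ
    visited  : List (Fin n)
    position : Dart n

setLabel : ∀ {n} → Rotation n → Dart n → ℕ → (Dart n → ℕ) → Dart n → ℕ
setLabel σ v a ℓ x = if does (sameVertex? σ v x) then a else ℓ x

-- The first corner incident to the outer face strictly after c, clockwise
-- around the vertex of c; it is c itself if there is no other.
nextOuter : ∀ {n} → Rotation n → Dart n → Dart n → Dart n
nextOuter σ root c =
  fromMaybe c (head (filter (_∈? face σ root) (drop 1 (orbit σ c))))

-- One step of the contour walk, from the corner c.  The part of the map between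
-- c and c₂ has the rotation detach c c₂ σ and the root c.  When the edge is a
-- bridge, c₁ and c₂ are equal and σ′ is σ.  The end of the edge is labeled after
-- the detachment: the end of a loop lies on the duplicate of its vertex.
step : ∀ {n} → Dart n → State n → State n
step root s =
  if does (edge c ∈ᵉ? visited)
  then record s { position = next σ c }
  else record
    { rotation = σ′
    ; label    = setLabel σ′ (α c) (outvᵤ (detach c c₂ σ) c) label
    ; visited  = edge c ∷ visited
    ; position = next σ′ c
    }
  where
  open State s renaming (rotation to σ; position to c)
  c₁ = σ c
  c₂ = nextOuter σ root c
  σ′ = detach c₁ c₂ σ

steps : ∀ {n} → Dart n → ℕ → State n → State n
steps root zero    s = s
steps root (suc k) s = steps root k (step root s)

-- The walk follows both sides of every edge of the resulting tree.  Only the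
-- root is labeled at the start: the label 0 of the other vertices is arbitrary.
walk : ∀ {n} → Rotation n → Dart n → State n
walk {n} σ root = steps root (n * 2) record
  { rotation = σ
  ; label    = setLabel σ root (outv (rooted σ (just root))) (const 0)
  ; visited  = []
  ; position = root
  }

-- The plane tree, of height at most k, whose root is labeled a and has the
-- darts ds, listed clockwise from the root corner or from the parent edge; this
-- is from right to left.
readTree : ∀ {n} → Rotation n → (Dart n → ℕ) → ℕ → ℕ → List (Dart n) → Tree
readTree σ ℓ zero    a ds = node a []
readTree σ ℓ (suc k) a ds =
  node a (map (λ d → readTree σ ℓ k (ℓ (α d)) (drop 1 (orbit σ (α d))))
              (reverse ds))

ρ′-rooted : ∀ {n} → Rooted n → Tree
ρ′-rooted     (rooted σ nothing)  = node 1 []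
ρ′-rooted {n} (rooted σ (just c)) = readTree σ′ ℓ n (ℓ c) (orbit σ′ c)
  where open State (walk σ c) using () renaming (rotation to σ′; label to ℓ)

ρ′ : ∀ {n} → RootedPlanarMap n → Tree
ρ′ M = ρ′-rooted (underlying M)

module Submission where

-- The first visit of an edge c by the contour walk cuts the one-corner component
-- U of c out of its vertex except for c itself, and merges the inner face next
-- to c into the outer face: what remains between c and α c is exactly Π(U).  By
-- induction on the number of edges, the walk therefore turns Π(U) into the tree
-- of the recursion, comes back along α c to the next outer corner of the root
-- vertex, and continues with the next component; it never touches anything
-- outside of the component it explores.
--
-- Planarity enters only through the Jordan property: splitting a vertex at two
-- corners of the same face disconnects the map.  It follows from Euler's
-- inequality V + F ≤ E + 2C, because such a splitting increases V and F by 1.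

open import Defs
open import Data.Bool using (Bool; true; false; if_then_else_)
open import Data.Bool.Properties using (not-involutive)
open import Data.Empty using (⊥-elim)
open import Data.Fin using (Fin)
import Data.Fin.Properties as Fin
open import Data.List
  using (List; []; _∷_; _++_; length; iterate; takeWhile; allFin; map; filter; deduplicate;
         reverse; drop; head; cartesianProduct)
open import Data.List.Membership.Propositional using (_∈_; _∉_)
open import Data.List.Membership.Propositional.Properties
  using (∈-∃++; ∈-++⁺ˡ; ∈-++⁺ʳ; ∈-++⁻; ∈-allFin; ∈-map⁺; ∈-filter⁻; ∈-filter⁺;
         ∈-cartesianProduct⁺)
open import Data.List.Properties
  using (length-++; length-tabulate; length-map; filter-all; filter-accept; filter-reject;
         filter-none; filter-++; filter-notAll; map-cong-local; ∷-injectiveʳ; ++-identityʳ)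
open import Data.List.Relation.Unary.All as All using (All; []; _∷_)
import Data.List.Relation.Unary.All.Properties as All
open import Data.List.Relation.Unary.AllPairs as AllPairs using (AllPairs; []; _∷_)
import Data.List.Relation.Unary.AllPairs.Properties as AllPairs
open import Data.List.Relation.Unary.Any as Any using (here; there)
import Data.List.Relation.Unary.Any.Properties as Any
open import Data.List.Relation.Unary.Unique.Propositional using (Unique)
import Data.List.Relation.Unary.Unique.Propositional.Properties as Unique
open import Data.Maybe using (just; nothing; fromMaybe)
open import Data.Nat using (ℕ; zero; suc; _+_; _*_; _≤_; _<_; _≥_; z≤n; s≤s; s≤s⁻¹)
open import Data.Nat.Properties hiding (_≟_)
open import Data.Nat.Solver using (module +-*-Solver)
open import Data.Product using (_×_; _,_; proj₁; proj₂; ∃-syntax)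
open import Data.Sum as Sum using (_⊎_; inj₁; inj₂)
open import Data.Unit using (⊤; tt)
open import Function using (_∘_; id; const)
open import Function.Bundles using (Injection)
open import Function.Definitions using (Injective)
open import Function.Properties.Inverse using (↔⇒↣)
open import Relation.Binary.Construct.Closure.Equivalence using (EqClosure)
import Relation.Binary.Construct.Closure.Equivalence as Eq
open import Relation.Binary.Construct.Closure.ReflexiveTransitive using (ε; _◅_; _◅◅_)
import Relation.Binary.Construct.Closure.ReflexiveTransitive as Star
open import Relation.Binary.Construct.Closure.Symmetric using (fwd; bwd)
open import Relation.Binary.PropositionalEquality hiding ([_])
open import Relation.Nullary using (¬_; Dec; yes; no; does; contradiction)
open import Relation.Nullary.Decidable using (dec-true; dec-false; ¬?)
open import Relation.Unary using (Decidable)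


-- Iteration of a map, and orbits

-- The obstacle is that `ρ` works on ever smaller maps, while the walk keeps a single rotation of
-- the whole map in which each component is still glued to the rest. The two are compared through a
-- set K of darts and a local rotation τ. On K the current rotation is `swap c z ∘ τ`: the cycle of
-- τ at c is an interval of the current vertex, which goes on to z instead of closing up at c. This
-- form is stable. After the root edge has been entered, the pair (c, z) becomes (r, α c), where r
-- is the root of `Π`; when the vertex is cut at its next outer corner d, it becomes (c, d) and then
-- (d, z).
--
-- As `nextOuter` inspects the outer face of the whole current map, the part of this face outside of
-- K has to be carried along too. The Jordan property is what makes successive components disjoint
-- as sets of darts, so that the exploration of one cannot disturb another.

module _ {A : Set} where

  ∈-resp : ∀ {x : A} {ys zs} → ys ≡ zs → x ∈ ys → x ∈ zs
  ∈-resp {x} = subst (x ∈_)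

  unique-++⁻ : ∀ (us : List A) {vs} → Unique (us ++ vs) →
               Unique us × Unique vs × (∀ {x} → x ∈ us → x ∉ vs)
  unique-++⁻ []       u        = [] , u , λ ()
  unique-++⁻ (x ∷ us) (x≢ ∷ u) with unique-++⁻ us u
  ... | u₁ , u₂ , disj = All.++⁻ˡ us x≢ ∷ u₁ , u₂ , λ where
    (here refl) x∈vs → All.lookup (All.++⁻ʳ us x≢) x∈vs refl
    (there y∈)  y∈vs → disj y∈ y∈vs

  unique-++⁺ : ∀ {us vs : List A} → Unique us → Unique vs →
               (∀ {x} → x ∈ us → x ∉ vs) → Unique (us ++ vs)
  unique-++⁺ u v disj = Unique.++⁺ u v λ (p , q) → disj p q

  head∉tail : ∀ {x : A} {xs} → Unique (x ∷ xs) → x ∉ xs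
  head∉tail = Unique.Unique[x∷xs]⇒x∉xs

  ∉⇒All≢ : ∀ {x : A} {xs} → x ∉ xs → All (x ≢_) xs
  ∉⇒All≢ x∉ = All.tabulate λ y∈ x≡y → x∉ (subst (_∈ _) (sym x≡y) y∈)

  unique-⊆-length : ∀ (xs ys : List A) → Unique xs → (∀ {x} → x ∈ xs → x ∈ ys) →
                    length xs ≤ length ys
  unique-⊆-length []       ys u        sub = z≤n
  unique-⊆-length (x ∷ xs) ys (x≢ ∷ u) sub with ∈-∃++ (sub (here refl))
  ... | as , bs , refl = begin
    suc (length xs)               ≤⟨ s≤s (unique-⊆-length xs (as ++ bs) u sub′) ⟩
    suc (length (as ++ bs))       ≡⟨ cong suc (length-++ as) ⟩
    suc (length as + length bs)   ≡⟨ +-suc (length as) (length bs) ⟨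
    length as + suc (length bs)   ≡⟨ length-++ as ⟨
    length (as ++ x ∷ bs)         ∎
    where
    open ≤-Reasoning
    sub′ : ∀ {y} → y ∈ xs → y ∈ as ++ bs
    sub′ y∈ with ∈-++⁻ as (sub (there y∈))
    ... | inj₁ y∈as         = ∈-++⁺ˡ y∈as
    ... | inj₂ (here refl)  = contradiction refl (All.lookup x≢ y∈)
    ... | inj₂ (there y∈bs) = ∈-++⁺ʳ as y∈bs

∈-darts : ∀ {n} (x : Dart n) → x ∈ darts n
∈-darts (e , b) = ∈-cartesianProduct⁺ (∈-allFin e) (∈-bools b)
  where
  ∈-bools : ∀ b → b ∈ false ∷ true ∷ []
  ∈-bools false = here refl
  ∈-bools true  = there (here refl)

length-darts : ∀ n → length (darts n) ≡ n * 2
length-darts n = trans (pairs (allFin n)) (cong (_* 2) (length-tabulate {n = n} (λ i → i)))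
  where
  pairs : ∀ (xs : List (Fin n)) →
          length (cartesianProduct xs (false ∷ true ∷ [])) ≡ length xs * 2
  pairs []       = refl
  pairs (x ∷ xs) = cong (suc ∘ suc) (pairs xs)

unique-darts-length : ∀ {n} {xs : List (Dart n)} → Unique xs → length xs ≤ n * 2
unique-darts-length {n} {xs} u =
  ≤-trans (unique-⊆-length xs (darts n) u λ _ → ∈-darts _) (≤-reflexive (length-darts n))

α-involutive : ∀ {n} (x : Dart n) → α (α x) ≡ x
α-involutive (e , b) = cong (e ,_) (not-involutive b)

α≢ : ∀ {n} (x : Dart n) → α x ≢ x
α≢ (e , false) ()
α≢ (e , true)  ()

α-injective : ∀ {n} {x y : Dart n} → α x ≡ α y → x ≡ y
α-injective {x = x} {y} eq = trans (sym (α-involutive x)) (trans (cong α eq) (α-involutive y))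

same-edge : ∀ {n} (x y : Dart n) → edge x ≡ edge y → x ≡ y ⊎ x ≡ α y
same-edge (e , false) (_ , false) refl = inj₁ refl
same-edge (e , false) (_ , true)  refl = inj₂ refl
same-edge (e , true)  (_ , false) refl = inj₂ refl
same-edge (e , true)  (_ , true)  refl = inj₁ refl

module _ {n : ℕ} (a b : Dart n) where

  swap-left : swap a b a ≡ b
  swap-left rewrite dec-true (a ≟ a) refl = refl

  swap-right : swap a b b ≡ a
  swap-right with b ≟ a
  ... | yes b≡a = b≡a
  ... | no  _ rewrite dec-true (b ≟ b) refl = refl

  swap-other : ∀ {x} → x ≢ a → x ≢ b → swap a b x ≡ x
  swap-other {x} x≢a x≢b
    rewrite dec-false (x ≟ a) x≢a | dec-false (x ≟ b) x≢b = refl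

data SwapView {n} (a b x : Dart n) : Set where
  left  : x ≡ a → swap a b x ≡ b → SwapView a b x
  right : x ≡ b → swap a b x ≡ a → SwapView a b x
  other : x ≢ a → x ≢ b → swap a b x ≡ x → SwapView a b x

swap-view : ∀ {n} (a b x : Dart n) → SwapView a b x
swap-view a b x with x ≟ a
... | yes refl = left refl (swap-left a b)
... | no x≢a with x ≟ b
... | yes refl = right refl (swap-right a b)
... | no x≢b  = other x≢a x≢b (swap-other a b x≢a x≢b)

swap-same : ∀ {n} (a x : Dart n) → swap a a x ≡ x
swap-same a x with x ≟ a
... | yes refl = refl
... | no x≢a with x ≟ a
... | yes refl = refl
... | no  _    = refl

swap-comm : ∀ {n} (a b x : Dart n) → swap a b x ≡ swap b a x
swap-comm a b x with swap-view a b x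
... | left refl eq       = trans eq (sym (swap-right b a))
... | right refl eq      = trans eq (sym (swap-left b a))
... | other x≢a x≢b eq = trans eq (sym (swap-other b a x≢b x≢a))

module _ {n : ℕ} (a b : Dart n) where

  swap-involutive : ∀ x → swap a b (swap a b x) ≡ x
  swap-involutive x with swap-view a b x
  ... | left refl eq     = trans (cong (swap a b) eq) (swap-right a b)
  ... | right refl eq    = trans (cong (swap a b) eq) (swap-left a b)
  ... | other _ _ eq     = trans (cong (swap a b) eq) eq

  swap-injective : ∀ {x y} → swap a b x ≡ swap a b y → x ≡ y
  swap-injective {x} {y} eq =
    trans (sym (swap-involutive x)) (trans (cong (swap a b) eq) (swap-involutive y))

module _ {n : ℕ} (σ : Rotation n) where

  detach-injective : ∀ a b → Injective _≡_ _≡_ σ → Injective _≡_ _≡_ (detach a b σ)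
  detach-injective a b inj eq = inj (swap-injective a b eq)

  next-injective : Injective _≡_ _≡_ σ → Injective _≡_ _≡_ (next σ)
  next-injective inj eq = α-injective (inj eq)

-- Chain f x ws y: iterating f from x lists ws and then arrives at y.
data Chain {A : Set} (f : A → A) : A → List A → A → Set where
  []  : ∀ {x} → Chain f x [] x
  _∷_ : ∀ x {ws y} → Chain f (f x) ws y → Chain f x (x ∷ ws) y

infixr 5 _∷_

module _ {A : Set} {f : A → A} where

  chain-++ : ∀ {x us y vs z} → Chain f x us y → Chain f y vs z → Chain f x (us ++ vs) z
  chain-++ []      d = d
  chain-++ (x ∷ c) d = x ∷ chain-++ c d

  chain-split : ∀ {x} us {vs z} → Chain f x (us ++ vs) z →
                ∃[ y ] Chain f x us y × Chain f y vs z
  chain-split []       c       = _ , [] , c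
  chain-split (x ∷ us) (x ∷ c) with chain-split us c
  ... | y , c₁ , c₂ = y , x ∷ c₁ , c₂

  chain-split-at : ∀ {x} us {y vs z} → Chain f x (us ++ y ∷ vs) z →
                   Chain f x us y × Chain f y (y ∷ vs) z
  chain-split-at us c with chain-split us c
  ... | _ , c₁ , y ∷ c₂ = c₁ , y ∷ c₂

  chain-head : ∀ {x y ws z} → Chain f x (y ∷ ws) z → x ≡ y
  chain-head (x ∷ _) = refl

  chain-closed : ∀ {x ws y z} → Chain f x ws y → z ∈ ws → f z ∈ ws ⊎ f z ≡ y
  chain-closed (x ∷ [])      (here refl) = inj₂ refl
  chain-closed (x ∷ (_ ∷ c)) (here refl) = inj₁ (there (here refl))
  chain-closed (x ∷ c)       (there z∈)  with chain-closed c z∈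
  ... | inj₁ fz∈ = inj₁ (there fz∈)
  ... | inj₂ eq  = inj₂ eq

  cycle-closed : ∀ {x ws z} → Chain f x (x ∷ ws) x → z ∈ x ∷ ws → f z ∈ x ∷ ws
  cycle-closed c z∈ with chain-closed c z∈
  ... | inj₁ fz∈  = fz∈
  ... | inj₂ refl = here refl

  chain-All : ∀ {P : A → Set} → (∀ {x} → P x → P (f x)) →
              ∀ {x ws y} → P x → Chain f x ws y → P y × (∀ {z} → z ∈ ws → P z)
  chain-All step px []      = px , λ ()
  chain-All step px (x ∷ c) with chain-All step (step px) c
  ... | py , pws = py , λ { (here refl) → px ; (there z∈) → pws z∈ }

  chain-∷ʳ : ∀ {x ws y} → Chain f x ws y → Chain f x (ws ++ y ∷ []) (f y)
  chain-∷ʳ c = chain-++ c (_ ∷ [])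

  chain-predecessor : ∀ {x ws y} → Chain f x ws y → ws ≢ [] → ∃[ z ] z ∈ ws × f z ≡ y
  chain-predecessor []            ws≢ = ⊥-elim (ws≢ refl)
  chain-predecessor (x ∷ [])      _   = x , here refl , refl
  chain-predecessor (x ∷ (y ∷ c)) _   with chain-predecessor (y ∷ c) (λ ())
  ... | z , z∈ , eq = z , there z∈ , eq

  -- An injective f enters y only once, and the chain already does at its end.
  chain-fresh : Injective _≡_ _≡_ f → ∀ {x ws y} → Chain f x ws y → Unique ws →
                y ≢ x → y ∉ ws
  chain-fresh inj {y = y} c u y≢x y∈ with ∈-∃++ y∈
  ... | []      , vs , refl = y≢x (sym (chain-head c))
  ... | u′ ∷ us , vs , refl with chain-split-at (u′ ∷ us) c | unique-++⁻ (u′ ∷ us) u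
  ... | c₁ , c₂ | _ , _ , disj
    with chain-predecessor c₁ (λ ()) | chain-predecessor c₂ (λ ())
  ... | p , p∈ , fp | q , q∈ , fq =
    disj p∈ (subst (_∈ _) (inj (trans fq (sym fp))) q∈)

chain-cong : ∀ {A : Set} {f g : A → A} {x ws y} → (∀ {w} → w ∈ ws → g w ≡ f w) →
             Chain f x ws y → Chain g x ws y
chain-cong eq []      = []
chain-cong eq (x ∷ c) =
  x ∷ subst (λ z → Chain _ z _ _) (sym (eq (here refl))) (chain-cong (eq ∘ there) c)

-- Here π will be a transposition. It has to fix the darts entered inside the chain, but not the
-- start, which is not entered; only the arrival moves. In this way one swap splits a cycle, joins
-- two cycles or opens one.
chain-redirect : ∀ {A : Set} {f g : A → A} (π : A → A) {x w ws y} → Chain f x (w ∷ ws) y →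
                 (∀ {v} → v ∈ w ∷ ws → g v ≡ π (f v)) → (∀ {v} → v ∈ ws → π v ≡ v) →
                 Chain g x (w ∷ ws) (π y)
chain-redirect {g = g} π (x ∷ []) eq fix =
  x ∷ subst (λ z → Chain g z [] (π _)) (sym (eq (here refl))) []
chain-redirect {g = g} π (x ∷ (y ∷ c)) eq fix =
  x ∷ subst (λ z → Chain g z (y ∷ _) _)
        (sym (trans (eq (here refl)) (fix (here refl))))
        (chain-redirect π (y ∷ c) (eq ∘ there) (fix ∘ there))

module _ {n : ℕ} {f : Dart n → Dart n} where

  private
    run : Dart n → Dart n → ℕ → List (Dart n)
    run x y N = takeWhile (λ z → ¬? (z ≟ x)) (iterate f y N)

    run-stop : ∀ x N → run x x N ≡ [] 
    run-stop x zero    = refl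
    run-stop x (suc N) rewrite dec-true (x ≟ x) refl = refl

    run-step : ∀ {x y} N → y ≢ x → run x y (suc N) ≡ y ∷ run x (f y) N
    run-step {x} {y} N y≢x rewrite dec-false (y ≟ x) y≢x = refl

    run-chain : ∀ {x y ws z} k → Chain f y ws z → x ∉ ws →
                run x y (length ws + k) ≡ ws ++ run x z k
    run-chain k []      x∉ = refl
    run-chain k (y ∷ c) x∉ =
      trans (run-step _ λ { refl → x∉ (here refl) }) (cong (y ∷_) (run-chain k c (x∉ ∘ there)))

    run-∈ : ∀ {x y z} N → z ∈ run x y N → ∃[ ws ] Chain f y ws z
    run-∈ {x} {y} (suc N) z∈ with y ≟ x
    run-∈ {x} {y} (suc N) () | yes _
    run-∈ {x} {y} (suc N) (here refl) | no _ = [] , []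
    run-∈ {x} {y} (suc N) (there z∈) | no _ with run-∈ N z∈
    ... | ws , c = y ∷ ws , y ∷ c

  ∈-orbit⇒chain : ∀ {x y} → y ∈ orbit f x → ∃[ ws ] Chain f x ws y
  ∈-orbit⇒chain (here refl) = [] , []
  ∈-orbit⇒chain {x} (there y∈) with run-∈ (n * 2) y∈
  ... | ws , c = x ∷ ws , x ∷ c

  -- The bound `n * 2` built into `orbit` truncates nothing, because a list of distinct darts is at
  -- most that long.
  cycle⇒orbit : ∀ {x ws} → Chain f x (x ∷ ws) x → Unique (x ∷ ws) → orbit f x ≡ x ∷ ws
  cycle⇒orbit {x} {ws} (x ∷ c) u with m≤n⇒∃[o]m+o≡n (<⇒≤ (unique-darts-length u))
  ... | k , eq = cong (x ∷_) (begin
    run x (f x) (n * 2)         ≡⟨ cong (run x (f x)) eq ⟨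
    run x (f x) (length ws + k) ≡⟨ run-chain k c (head∉tail u) ⟩
    ws ++ run x x k             ≡⟨ cong (ws ++_) (run-stop x k) ⟩
    ws ++ []                    ≡⟨ ++-identityʳ ws ⟩
    ws                          ∎)
    where open ≡-Reasoning

  -- For a vertex of which only an initial interval is known, the remainder lying outside of the
  -- component at hand.
  orbit-prefix : ∀ {x ws y} → Chain f x (x ∷ ws) y → Unique (x ∷ ws) → y ≢ x →
                 ∃[ vs ] orbit f x ≡ x ∷ ws ++ y ∷ vs
  orbit-prefix {x} {ws} {y} (x ∷ c) u y≢x with m≤n⇒∃[o]m+o≡n (unique-darts-length u)
  ... | k , eq = run x (f y) k , cong (x ∷_) (begin
    run x (f x) (n * 2)                ≡⟨ cong (run x (f x)) (trans (+-suc _ k) eq) ⟨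
    run x (f x) (length ws + suc k)    ≡⟨ run-chain (suc k) c (head∉tail u) ⟩
    ws ++ run x y (suc k)              ≡⟨ cong (ws ++_) (run-step k y≢x) ⟩
    ws ++ y ∷ run x (f y) k            ∎)
    where open ≡-Reasoning

  module _ (inj : Injective _≡_ _≡_ f) where

    private
      -- The darts of the chain stay distinct by `chain-fresh`, so their number cannot exceed
      -- `n * 2` and the chain returns before k is used up.
      close : ∀ k {x ws y} → Chain f x (x ∷ ws) y → Unique (x ∷ ws) →
              n * 2 < length ws + k → ∃[ vs ] Chain f x (x ∷ vs) x × Unique (x ∷ vs)
      close k {x} {ws} {y} c u lt with y ≟ x
      ... | yes refl = ws , c , u
      close zero {x} {ws} c u lt | no y≢x =
        ⊥-elim (1+n≰n (≤-trans (≤-trans lt (≤-reflexive (+-identityʳ _)))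
                               (≤-trans (n≤1+n _) (unique-darts-length u))))
      close (suc k) {x} {ws} {y} c u lt | no y≢x =
        close k (chain-∷ʳ c)
          (unique-++⁺ u ([] ∷ []) λ { z∈ (here refl) → chain-fresh inj c u y≢x z∈ })
          (≤-trans lt (≤-reflexive (begin
            length ws + suc k            ≡⟨ +-suc _ k ⟩
            suc (length ws + k)          ≡⟨ cong (_+ k) (trans (sym (+-comm (length ws) 1)) (sym (length-++ ws))) ⟩
            length (ws ++ y ∷ []) + k    ∎)))
        where open ≡-Reasoning

    orbit-tail : ∀ x → ∃[ ws ] orbit f x ≡ x ∷ ws × Chain f x (x ∷ ws) x × Unique (x ∷ ws)
    orbit-tail x with close (suc (n * 2)) (x ∷ []) ([] ∷ []) ≤-refl
    ... | ws , c , u = ws , cycle⇒orbit c u , c , u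

    ∈-orbit-step : ∀ {x y} → y ∈ orbit f x → f y ∈ orbit f x
    ∈-orbit-step {x} {y} y∈ with orbit-tail x
    ... | ws , eq , c , u = ∈-resp (sym eq) (cycle-closed c (∈-resp eq y∈))

    chain⇒∈-orbit : ∀ {x ws y} → Chain f x ws y → y ∈ orbit f x
    chain⇒∈-orbit {x} c = proj₁ (chain-All {P = _∈ orbit f x} ∈-orbit-step (here refl) c)

    ∈-orbit-trans : ∀ {x y z} → y ∈ orbit f x → z ∈ orbit f y → z ∈ orbit f x
    ∈-orbit-trans y∈ z∈ with ∈-orbit⇒chain y∈ | ∈-orbit⇒chain z∈
    ... | _ , c | _ , d = chain⇒∈-orbit (chain-++ c d)

    ∈-orbit-sym : ∀ {x y} → y ∈ orbit f x → x ∈ orbit f y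
    ∈-orbit-sym {x} {y} y∈ with orbit-tail x
    ... | ws , eq , c , u with ∈-∃++ (∈-resp eq y∈)
    ... | us , vs , eq′ =
      chain⇒∈-orbit (proj₂ (chain-split-at us (subst (λ l → Chain f x l x) eq′ c)))

    ∈-cycle⇔∈-orbit : ∀ {x y ws z} → Chain f x ws x → y ∈ ws →
                      (z ∈ ws → z ∈ orbit f y) × (z ∈ orbit f y → z ∈ ws)
    ∈-cycle⇔∈-orbit {x} {y} {w ∷ ws} {z} c y∈ with chain-head c
    ... | refl = to , λ z∈ → proj₁ (chain-All {P = _∈ x ∷ ws} (cycle-closed c) y∈ (proj₂ (∈-orbit⇒chain z∈)))
      where
      from-x : ∀ {v} → v ∈ x ∷ ws → v ∈ orbit f x
      from-x v∈ with ∈-∃++ v∈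
      ... | us , vs , eq =
        chain⇒∈-orbit (proj₁ (chain-split-at us (subst (λ l → Chain f x l x) eq c)))
      to : z ∈ x ∷ ws → z ∈ orbit f y
      to z∈ = ∈-orbit-trans (∈-orbit-sym (from-x y∈)) (from-x z∈)

-- Euler's inequality and the Jordan property

Step : ∀ {n} → Rotation n → Dart n → Dart n → Set
Step σ u v = v ≡ σ u ⊎ v ≡ α u

Conn : ∀ {n} → Rotation n → Dart n → Dart n → Set
Conn σ = EqClosure (Step σ)

module _ {n : ℕ} {σ : Rotation n} where

  conn-sym : ∀ {x y} → Conn σ x y → Conn σ y x
  conn-sym = Eq.symmetric (Step σ)

  conn-σ : ∀ {x} → Conn σ x (σ x)
  conn-σ = fwd (inj₁ refl) ◅ ε

  conn-α : ∀ {x} → Conn σ x (α x)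
  conn-α = fwd (inj₂ refl) ◅ ε

  chain⇒conn : ∀ {x ws y} → Chain σ x ws y → Conn σ x y
  chain⇒conn []      = ε
  chain⇒conn (x ∷ c) = conn-σ ◅◅ chain⇒conn c

  vertex⇒conn : ∀ {x y} → y ∈ orbit σ x → Conn σ x y
  vertex⇒conn y∈ = chain⇒conn (proj₂ (∈-orbit⇒chain y∈))

  chain-next⇒conn : ∀ {x ws y} → Chain (next σ) x ws y → Conn σ x y
  chain-next⇒conn []      = ε
  chain-next⇒conn (x ∷ c) = conn-α ◅◅ conn-σ ◅◅ chain-next⇒conn c

  face⇒conn : ∀ {x y} → y ∈ face σ x → Conn σ x y
  face⇒conn y∈ = chain-next⇒conn (proj₂ (∈-orbit⇒chain y∈))

Independent : ∀ {n} → (Dart n → Dart n) → List (Dart n) → Set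
Independent f = AllPairs (λ x y → y ∉ orbit f x)

module _ {n : ℕ} {f : Dart n → Dart n} (inj : Injective _≡_ _≡_ f) (a b : Dart n) where

  private
    f′ : Dart n → Dart n
    f′ = detach a b f
    inj′ : Injective _≡_ _≡_ f′
    inj′ = detach-injective f a b inj

  -- The permutation f is arbitrary because `next (detach a b σ)` is `detach a b (next σ)` by
  -- definition: the same lemmas apply to vertices and to faces.
  split-cycle : ∀ {u v} → Chain f a (a ∷ u ++ b ∷ v) a → Unique (a ∷ u ++ b ∷ v) →
                Chain f′ a (a ∷ u) a × Chain f′ b (b ∷ v) b
  split-cycle {u} {v} c uniq with chain-split-at (a ∷ u) c | unique-++⁻ (a ∷ u) uniq
  ... | c₁ , c₂ | u₁ , u₂ , disj =
    subst (Chain f′ a (a ∷ u)) (swap-right a b)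
      (chain-redirect (swap a b) c₁ (λ _ → refl) λ w∈ →
        swap-other a b (λ { refl → head∉tail u₁ w∈ }) (λ { refl → disj (there w∈) (here refl) })) ,
    subst (Chain f′ b (b ∷ v)) (swap-left a b)
      (chain-redirect (swap a b) c₂ (λ _ → refl) λ w∈ →
        swap-other a b (λ { refl → disj (here refl) (there w∈) }) (λ { refl → head∉tail u₂ w∈ }))

  split-separates : a ≢ b → b ∈ orbit f a → b ∉ orbit f′ a
  split-separates a≢b b∈ b∈′ with orbit-tail inj a
  ... | ws , eq , c , u with ∈-∃++ (∈-resp eq b∈)
  ... | []    , vs , refl = a≢b refl
  ... | _ ∷ us , vs , refl with split-cycle c u | unique-++⁻ (a ∷ us) u
  ... | c₁ , _ | u₁ , _ , disj =
    disj (∈-resp (cycle⇒orbit c₁ u₁) b∈′) (here refl)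

  merge-joins : b ∉ orbit f a → b ∈ orbit f′ a
  merge-joins b∉ with orbit-tail inj a
  ... | ws , eq , c , u = chain⇒∈-orbit inj′
    (subst (Chain f′ a (a ∷ ws)) (swap-left a b)
      (chain-redirect (swap a b) c (λ _ → refl) λ w∈ →
        swap-other a b (λ { refl → head∉tail u w∈ })
          (λ { refl → b∉ (∈-resp (sym eq) (there w∈)) })))

  private
    Near : Dart n → Set
    Near x = x ∈ orbit f a ⊎ x ∈ orbit f b

    near-back : ∀ {x y} → y ∈ orbit f x → Near y → Near x
    near-back y∈ = Sum.map (λ p → ∈-orbit-trans inj p (∈-orbit-sym inj y∈))
                           (λ p → ∈-orbit-trans inj p (∈-orbit-sym inj y∈))

    near-forth : ∀ {x y} → y ∈ orbit f x → Near x → Near y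
    near-forth y∈ = Sum.map (λ p → ∈-orbit-trans inj p y∈) (λ p → ∈-orbit-trans inj p y∈)

    -- An upper bound on the orbits of f′ valid for splits and merges alike: they are no coarser
    -- than those of f with the orbits of a and b united.
    Related : Dart n → Dart n → Set
    Related x y = y ∈ orbit f x ⊎ Near x × Near y

    related-trans : ∀ {x y z} → Related x y → Related y z → Related x z
    related-trans (inj₁ p)       (inj₁ q)       = inj₁ (∈-orbit-trans inj p q)
    related-trans (inj₁ p)       (inj₂ (q , r)) = inj₂ (near-back p q , r)
    related-trans (inj₂ (p , q)) (inj₁ r)       = inj₂ (p , near-forth r q)
    related-trans (inj₂ (p , _)) (inj₂ (_ , q)) = inj₂ (p , q)

    f∈ : ∀ {x} → f x ∈ orbit f x
    f∈ = ∈-orbit-step inj (here refl)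

    related-step : ∀ x → Related x (f′ x)
    related-step x with swap-view a b (f x)
    ... | left eq eq′  = inj₂ (near-back f∈ (inj₁ (subst (_∈ orbit f a) (sym eq) (here refl))) ,
                               inj₂ (subst (_∈ orbit f b) (sym eq′) (here refl)))
    ... | right eq eq′ = inj₂ (near-back f∈ (inj₂ (subst (_∈ orbit f b) (sym eq) (here refl))) ,
                               inj₁ (subst (_∈ orbit f a) (sym eq′) (here refl)))
    ... | other _ _ eq = inj₁ (subst (_∈ orbit f x) (sym eq) f∈)

    related-chain : ∀ {x ws y} → Chain f′ x ws y → Related x y
    related-chain []      = inj₁ (here refl)
    related-chain (x ∷ c) = related-trans (related-step x) (related-chain c)

    related : ∀ {x y} → y ∈ orbit f′ x → Related x y
    related y∈ = related-chain (proj₂ (∈-orbit⇒chain y∈))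

    others : List (Dart n) → List (Dart n)
    others = filter (λ x → ¬? (x ∈? orbit f a))

    others-all : ∀ {xs} → All (_∉ orbit f a) xs → others xs ≡ xs
    others-all = filter-all (λ x → ¬? (x ∈? orbit f a))

    -- An independent list meets the orbit of a at most once.
    length-others : ∀ {xs} → Independent f xs → length xs ≤ suc (length (others xs))
    length-others []             = z≤n
    length-others {x ∷ xs} (x# ∷ i) with x ∈? orbit f a
    ... | yes x∈ = s≤s (≤-reflexive (cong length (sym (trans
      (filter-reject (λ y → ¬? (y ∈? orbit f a)) {x} {xs} λ x∉ → x∉ x∈)
      (others-all (All.map (λ y∉ y∈ → y∉ (∈-orbit-trans inj (∈-orbit-sym inj x∈) y∈)) x#))))))
    ... | no  x∉ = ≤-trans (s≤s (length-others i)) (≤-reflexive (cong (suc ∘ length)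
      (sym (filter-accept (λ y → ¬? (y ∈? orbit f a)) {x} {xs} x∉))))

    others-∉ : ∀ {x} xs → x ∈ others xs → x ∉ orbit f a
    others-∉ xs x∈ = proj₂ (∈-filter⁻ (λ x → ¬? (x ∈? orbit f a)) {xs = xs} x∈)

    others-independent : ∀ {xs} → Independent f xs → Independent f (others xs)
    others-independent = AllPairs.filter⁺ _

  private
    map-independent : ∀ {g h : Dart n → Dart n} {xs : List (Dart n)} →
                      (∀ {x y} → x ∈ xs → y ∈ xs → y ∈ orbit h x → y ∈ orbit g x) →
                      Independent g xs → Independent h xs
    map-independent sub []       = []
    map-independent sub (p ∷ ps) =
      All.tabulate (λ y∈ q → All.lookup p y∈ (sub (here refl) (there y∈) q)) ∷
      map-independent (λ x∈ y∈ → sub (there x∈) (there y∈)) ps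

  detach-independent : ∀ {xs} → Independent f xs →
                       ∃[ ys ] Independent f′ ys × length xs ≤ suc (length ys)
  detach-independent {xs} i =
    -- Once the representative of the orbit of a is dropped, the united orbit retains at most that
    -- of b.
    others xs , map-independent sub (others-independent i) , length-others i
    where
    sub : ∀ {x y} → x ∈ others xs → y ∈ others xs → y ∈ orbit f′ x → y ∈ orbit f x
    sub x∈ y∈ y~x with related y~x
    ... | inj₁ p                 = p
    ... | inj₂ (inj₁ p , _)      = contradiction p (others-∉ xs x∈)
    ... | inj₂ (inj₂ _ , inj₁ q) = contradiction q (others-∉ xs y∈)
    ... | inj₂ (inj₂ p , inj₂ q) = ∈-orbit-trans inj (∈-orbit-sym inj p) q

  split-independent : a ≢ b → b ∈ orbit f a → ∀ {xs} → Independent f xs →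
                      ∃[ ys ] Independent f′ ys × suc (length xs) ≤ length ys
  split-independent a≢b b∈ {xs} i =
    -- At most one representative is dropped and two are added, for a net gain of one.
    a ∷ b ∷ others xs ,
    (split-separates a≢b b∈ ∷ All.tabulate (λ y∈ y~ → others-∉ xs y∈ (refine y~))) ∷
    All.tabulate (λ y∈ y~ → others-∉ xs y∈ (∈-orbit-trans inj b∈ (refine y~))) ∷
    map-independent (λ _ _ → refine) (others-independent i) ,
    s≤s (length-others i)
    where
    refine : ∀ {x y} → y ∈ orbit f′ x → y ∈ orbit f x
    refine y~x with related y~x
    ... | inj₁ p       = p
    ... | inj₂ (p , q) = ∈-orbit-trans inj (∈-orbit-sym inj (near p)) (near q)
      where
      near : ∀ {x} → Near x → x ∈ orbit f a
      near (inj₁ p) = p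
      near (inj₂ p) = ∈-orbit-trans inj b∈ p

Generating : ∀ {n} → Rotation n → List (Dart n) → Set
Generating σ ls = ∀ x → ∃[ l ] l ∈ ls × Conn σ x l

module _ {n : ℕ} {σ : Rotation n} (a b : Dart n) where

  private
    σ′ : Rotation n
    σ′ = detach a b σ

    Reached : Dart n → Dart n → Set
    Reached x y = Conn σ′ x y ⊎ Conn σ′ x a ⊎ Conn σ′ x b

    extend : ∀ {x y z} → Conn σ′ x y → Reached y z → Reached x z
    extend c = Sum.map (c ◅◅_) (Sum.map (c ◅◅_) (c ◅◅_))

    σ-edge : ∀ u → Conn σ′ u (σ u) ⊎ (Conn σ′ u a × σ u ≡ b) ⊎ (Conn σ′ u b × σ u ≡ a)
    σ-edge u with swap-view a b (σ u)
    ... | left eq eq′  = inj₂ (inj₂ (subst (Conn σ′ u) eq′ conn-σ , eq))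
    ... | right eq eq′ = inj₂ (inj₁ (subst (Conn σ′ u) eq′ conn-σ , eq))
    ... | other _ _ eq = inj₁ (subst (Conn σ′ u) eq conn-σ)

  -- Up to its first step altered by the swap, a path of σ is a path of σ′; an altered step starts
  -- at a or b, or is redirected there.
  conn-detach : ∀ {x y} → Conn σ x y → Conn σ′ x y ⊎ Conn σ′ x a ⊎ Conn σ′ x b
  conn-detach ε = inj₁ ε
  conn-detach (fwd (inj₁ refl) ◅ c) with σ-edge _
  ... | inj₁ d              = extend d (conn-detach c)
  ... | inj₂ (inj₁ (d , _)) = inj₂ (inj₁ d)
  ... | inj₂ (inj₂ (d , _)) = inj₂ (inj₂ d)
  conn-detach (fwd (inj₂ refl) ◅ c) = extend conn-α (conn-detach c)
  conn-detach (bwd (inj₁ refl) ◅ c) with σ-edge _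
  ... | inj₁ d               = extend (conn-sym d) (conn-detach c)
  ... | inj₂ (inj₁ (_ , eq)) = inj₂ (inj₂ (subst (Conn σ′ _) eq ε))
  ... | inj₂ (inj₂ (_ , eq)) = inj₂ (inj₁ (subst (Conn σ′ _) eq ε))
  conn-detach (bwd (inj₂ refl) ◅ c) = extend (conn-sym conn-α) (conn-detach c)

  private
    conn-a : ∀ {x} → Conn σ x a → Conn σ′ x a ⊎ Conn σ′ x b
    conn-a c = Sum.[ inj₁ , id ] (conn-detach c)

  conn-detach-joined : Conn σ′ a b → ∀ {x y} → Conn σ x y → Conn σ′ x y
  conn-detach-joined a~b = Eq.fold (Eq.isEquivalence (Step σ′)) on-step
    where
    on-step : ∀ {u v} → Step σ u v → Conn σ′ u v
    on-step (inj₂ refl) = conn-α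
    on-step (inj₁ refl) with σ-edge _
    ... | inj₁ d               = d
    ... | inj₂ (inj₁ (d , eq)) = subst (Conn σ′ _) (sym eq) (d ◅◅ a~b)
    ... | inj₂ (inj₂ (d , eq)) = subst (Conn σ′ _) (sym eq) (d ◅◅ conn-sym a~b)

  generating-joined : Conn σ′ a b → ∀ {ls} → Generating σ ls → Generating σ′ ls
  generating-joined a~b gen x with gen x
  ... | l , l∈ , c = l , l∈ , conn-detach-joined a~b c

  -- The representative of a in σ stays connected to a or to b; the other of
  -- the two becomes a new representative.
  generating-split : ∀ {ls} → Generating σ ls →
                     ∃[ ks ] Generating σ′ ks × length ks ≡ suc (length ls)
  generating-split {ls} gen with gen a
  ... | l , l∈ , c with conn-a (conn-sym c)
  ... | inj₁ l~a = b ∷ ls , gen′ , refl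
    where
    gen′ : Generating σ′ (b ∷ ls)
    gen′ x with gen x
    ... | k , k∈ , d with conn-detach d
    ... | inj₁ x~k        = k , there k∈ , x~k
    ... | inj₂ (inj₁ x~a) = l , there l∈ , x~a ◅◅ conn-sym l~a
    ... | inj₂ (inj₂ x~b) = b , here refl , x~b
  ... | inj₂ l~b = a ∷ ls , gen′ , refl
    where
    gen′ : Generating σ′ (a ∷ ls)
    gen′ x with gen x
    ... | k , k∈ , d with conn-detach d
    ... | inj₁ x~k        = k , there k∈ , x~k
    ... | inj₂ (inj₁ x~a) = a , here refl , x~a
    ... | inj₂ (inj₂ x~b) = l , there l∈ , x~b ◅◅ conn-sym l~b

independent⇒unique : ∀ {n} {f : Dart n → Dart n} {xs} → Independent f xs → Unique xs
independent⇒unique = AllPairs.map λ y∉ → λ { refl → y∉ (here refl) }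

-- A certificate instead of exact counts: independent lists bound V and F from below, a generating
-- list bounds C from above. Euler's inequality holds for every certificate, and genus 0 asks for a
-- single one that reaches the bound.
record Counted {n} (σ : Rotation n) : Set where
  field
    {vertices} {faces} {components} : List (Dart n)
    vertices-independent : Independent σ vertices
    faces-independent    : Independent (next σ) faces
    generating           : Generating σ components

  #v #f #c : ℕ
  #v = length vertices
  #f = length faces
  #c = length components

open Counted using (#v; #f; #c)

-- V + F − 2C does not decrease, with both sides moved so that no subtraction occurs.
detach-counted : ∀ {n} {σ : Rotation n} {a b} → Injective _≡_ _≡_ σ → a ≢ b → b ∈ orbit σ a →
                 (N : Counted σ) → ∃[ N′ ] #v {σ = detach a b σ} N′ + #f N′ + #c N * 2 ≥
                                           #v N + #f N + #c N′ * 2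
detach-counted {σ = σ} {a} {b} inj a≢b b∈ N
  with split-independent inj a b a≢b b∈ (Counted.vertices-independent N) | b ∈? face σ a
-- Same face: V and F both gain one, and C grows by one at most.
... | vs , iv , v≥ | yes b∈f
  with split-independent (next-injective σ inj) a b a≢b b∈f (Counted.faces-independent N)
     | generating-split {σ = σ} a b (Counted.generating N)
... | fs , if , f≥ | ls , gen , l= =
  record { vertices-independent = iv ; faces-independent = if ; generating = gen } , (begin
    #v N + #f N + length ls * 2             ≡⟨ cong (λ k → #v N + #f N + k * 2) l= ⟩
    #v N + #f N + (2 + #c N * 2)            ≡⟨ solve 3 (λ v f c → v :+ f :+ (con 2 :+ c) := (con 1 :+ v) :+ (con 1 :+ f) :+ c) refl (#v N) (#f N) (#c N * 2) ⟩
    suc (#v N) + suc (#f N) + #c N * 2      ≤⟨ +-monoˡ-≤ (#c N * 2) (+-mono-≤ v≥ f≥) ⟩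
    length vs + length fs + #c N * 2        ∎)
  where open ≤-Reasoning
        open +-*-Solver
-- Different faces: they merge, and V makes up for the face that may be lost. The merged face
-- connects a to b, so the same list still generates.
detach-counted {σ = σ} {a} {b} inj a≢b b∈ N | vs , iv , v≥ | no b∉f
  with detach-independent (next-injective σ inj) a b (Counted.faces-independent N)
... | fs , if , f≥ =
  record { vertices-independent = iv ; faces-independent = if
         ; generating = generating-joined {σ = σ} a b
             (face⇒conn (merge-joins (next-injective σ inj) a b b∉f)) (Counted.generating N) } ,
  +-monoˡ-≤ (#c N * 2) (begin
    #v N + #f N                ≤⟨ +-monoʳ-≤ (#v N) f≥ ⟩
    #v N + suc (length fs)     ≡⟨ +-suc (#v N) (length fs) ⟩
    suc (#v N) + length fs     ≤⟨ +-monoˡ-≤ (length fs) v≥ ⟩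
    length vs + length fs      ∎)
  where open ≤-Reasoning

private
  -- Every dart is alone at its vertex, so the map consists of n separate edges: V ≤ 2n, F ≤ n and C
  -- ≥ n.
  euler-fixed : ∀ {n} {σ : Rotation n} → Injective _≡_ _≡_ σ → (∀ d → σ d ≡ d) → (N : Counted σ) →
                #v N + #f N ≤ n + #c N * 2
  euler-fixed {n} {σ} inj fixed N = begin
    #v N + #f N        ≤⟨ +-mono-≤ (unique-darts-length (independent⇒unique (Counted.vertices-independent N))) f≤ ⟩
    n * 2 + n          ≡⟨ +-comm (n * 2) n ⟩
    n + n * 2          ≤⟨ +-monoʳ-≤ n (*-monoˡ-≤ 2 ≤c) ⟩
    n + #c N * 2       ∎
    where
    open ≤-Reasoning
    length-allFin : length (allFin n) ≡ n
    length-allFin = length-tabulate {n = n} id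
    f≤ : #f N ≤ n
    f≤ = begin
      #f N                          ≡⟨ length-map edge (Counted.faces N) ⟨
      length (map edge (Counted.faces N))   ≤⟨ unique-⊆-length _ (allFin n)
        (AllPairs.map⁺ (AllPairs.map distinct (Counted.faces-independent N))) (λ _ → ∈-allFin _) ⟩
      length (allFin n)             ≡⟨ length-allFin ⟩
      n                             ∎
      where
      distinct : ∀ {x y} → y ∉ face σ x → edge x ≢ edge y
      distinct {x} {y} y∉ eq with same-edge y x (sym eq)
      ... | inj₁ refl = y∉ (here refl)
      ... | inj₂ refl = y∉ (subst (_∈ face σ x) (fixed (α x)) (∈-orbit-step (next-injective σ inj) (here refl)))
    same : ∀ {x y} → Conn σ x y → edge x ≡ edge y
    same = Eq.fold (record { refl = refl ; sym = sym ; trans = trans }) λ where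
      (inj₁ refl) → cong edge (sym (fixed _))
      (inj₂ refl) → refl
    ≤c : n ≤ #c N
    ≤c = begin
      n                             ≡⟨ length-allFin ⟨
      length (allFin n)             ≤⟨ unique-⊆-length (allFin n) _ (Unique.allFin⁺ n) covers ⟩
      length (map edge (Counted.components N)) ≡⟨ length-map edge (Counted.components N) ⟩
      #c N                          ∎
      where
      covers : ∀ {e} → e ∈ allFin n → e ∈ map edge (Counted.components N)
      covers {e} _ with Counted.generating N (e , false)
      ... | l , l∈ , c = subst (_∈ _) (sym (same c)) (∈-map⁺ edge l∈)

  -- Isolating the darts of ds one by one leads to the identity rotation, and V + F - 2C never
  -- decreases on the way.
  euler-on : ∀ {n} {σ : Rotation n} ds → Injective _≡_ _≡_ σ → (∀ d → d ∉ ds → σ d ≡ d) →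
             (N : Counted σ) → #v N + #f N ≤ n + #c N * 2
  euler-on []       inj fixed N = euler-fixed inj (λ d → fixed d λ ()) N
  euler-on {n} {σ} (a ∷ ds) inj fixed N with σ a ≟ a
  ... | yes σa≡a = euler-on ds inj fixed′ N
    where
    fixed′ : ∀ d → d ∉ ds → σ d ≡ d
    fixed′ d d∉ with d ≟ a
    ... | yes refl = σa≡a
    ... | no  d≢a  = fixed d λ { (here eq) → d≢a eq ; (there d∈) → d∉ d∈ }
  ... | no σa≢a with detach-counted inj (σa≢a ∘ sym) (∈-orbit-step inj (here refl)) N
  ... | N′ , ≤N′ = +-cancelʳ-≤ (#c N′ * 2) _ _ (begin
    #v N + #f N + #c N′ * 2            ≤⟨ ≤N′ ⟩
    #v N′ + #f N′ + #c N * 2           ≤⟨ +-monoˡ-≤ (#c N * 2) (euler-on ds (detach-injective σ a (σ a) inj) fixed′ N′) ⟩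
    n + #c N′ * 2 + #c N * 2           ≡⟨ solve 3 (λ k x y → k :+ x :+ y := k :+ y :+ x) refl n (#c N′ * 2) (#c N * 2) ⟩
    n + #c N * 2 + #c N′ * 2           ∎)
    where
    open ≤-Reasoning
    open +-*-Solver
    fixed′ : ∀ d → d ∉ ds → detach a (σ a) σ d ≡ d
    fixed′ d d∉ with d ≟ a
    ... | yes refl = swap-right a (σ a)
    ... | no  d≢a  = trans (cong (swap a (σ a)) σd≡d)
                       (swap-other a (σ a) d≢a λ d≡σa → d≢a (inj (trans σd≡d d≡σa)))
      where σd≡d = fixed d λ { (here eq) → d≢a eq ; (there d∈) → d∉ d∈ }

euler : ∀ {n} {σ : Rotation n} → Injective _≡_ _≡_ σ → (N : Counted σ) → #v N + #f N ≤ n + #c N * 2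
euler inj = euler-on (darts _) inj λ d d∉ → contradiction (∈-darts d) d∉

-- Only one inequality is recorded, `euler` being the other. Counting components makes the notion
-- apply to the disconnected rotations that arise from cutting and deleting.
record Planar {n} (σ : Rotation n) : Set where
  field
    injective : Injective _≡_ _≡_ σ
    counted   : Counted σ
    genus0    : n + #c counted * 2 ≤ #v counted + #f counted

planar-detach : ∀ {n} {σ : Rotation n} {a b} → a ≢ b → b ∈ orbit σ a → Planar σ → Planar (detach a b σ)
planar-detach {n} {σ} {a} {b} a≢b b∈ p with detach-counted (Planar.injective p) a≢b b∈ (Planar.counted p)
... | N′ , ≤N′ = record
  { injective = detach-injective σ a b (Planar.injective p)
  ; counted   = N′
  ; genus0    = +-cancelʳ-≤ (#c N * 2) _ _ (begin
      n + #c N′ * 2 + #c N * 2    ≡⟨ solve 3 (λ k x y → k :+ x :+ y := k :+ y :+ x) refl n (#c N′ * 2) (#c N * 2) ⟩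
      n + #c N * 2 + #c N′ * 2    ≤⟨ +-monoˡ-≤ (#c N′ * 2) (Planar.genus0 p) ⟩
      #v N + #f N + #c N′ * 2     ≤⟨ ≤N′ ⟩
      #v N′ + #f N′ + #c N * 2    ∎)
  }
  where
  open ≤-Reasoning
  open +-*-Solver
  N = Planar.counted p

jordan : ∀ {n} {σ : Rotation n} {a b} → Planar σ → a ≢ b → b ∈ orbit σ a → b ∈ face σ a →
         ¬ Conn (detach a b σ) a b
jordan {n} {σ} {a} {b} p a≢b b∈v b∈f a~b
  with split-independent (Planar.injective p) a b a≢b b∈v (Counted.vertices-independent (Planar.counted p))
     | split-independent (next-injective σ (Planar.injective p)) a b a≢b b∈f (Counted.faces-independent (Planar.counted p))
... | vs , iv , v≥ | fs , if , f≥ = 1+n≰n (begin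
  suc (#v N + #f N)            ≤⟨ n≤1+n _ ⟩
  2 + (#v N + #f N)            ≡⟨ cong suc (+-suc (#v N) (#f N)) ⟨
  suc (#v N) + suc (#f N)      ≤⟨ +-mono-≤ v≥ f≥ ⟩
  length vs + length fs        ≤⟨ euler (detach-injective σ a b (Planar.injective p)) N′ ⟩
  n + #c N * 2                 ≤⟨ Planar.genus0 p ⟩
  #v N + #f N                  ∎)
  where
  open ≤-Reasoning
  N = Planar.counted p
  N′ : Counted (detach a b σ)
  N′ = record { vertices-independent = iv ; faces-independent = if
              ; generating = generating-joined {σ = σ} a b a~b (Counted.generating N) }

deduplicate-independent : ∀ {n} {f : Dart n → Dart n} xs →
  Independent f (deduplicate (λ x y → y ∈? orbit f x) xs)
deduplicate-independent []       = []
deduplicate-independent {f = f} (x ∷ xs) =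
  All.all-filter (λ y → ¬? (y ∈? orbit f x)) (deduplicate (λ x y → y ∈? orbit f x) xs) ∷
  AllPairs.filter⁺ _ (deduplicate-independent xs)

planar-map : ∀ {n} {σ : Rotation n} → Dart n → Injective _≡_ _≡_ σ → Connected σ →
             #vertices σ + #faces σ ≡ n + 2 → Planar σ
planar-map {n} {σ} root inj connected count = record
  { injective = inj
  ; counted   = record
    { components           = root ∷ []
    ; vertices-independent = deduplicate-independent (darts n)
    ; faces-independent    = deduplicate-independent (darts n)
    ; generating           = λ x → root , here refl , Star.map fwd (connected x root)
    }
  ; genus0    = ≤-reflexive (sym count)
  }

-- The recursion depends only on the component of the root

All-reverse : ∀ {A : Set} {P : A → Set} {xs} → All P xs → All P (reverse xs)
All-reverse ps = All.tabulate λ x∈ → All.lookup ps (Any.reverse⁻ x∈)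

module _ {A : Set} {P : A → Set} (P? : Decidable P) where

  filter-≡[] : ∀ {xs} → filter P? xs ≡ [] → ∀ {x} → x ∈ xs → ¬ P x
  filter-≡[] eq x∈ px with ∈-resp eq (∈-filter⁺ P? x∈ px)
  ... | ()

  filter-≡∷ : ∀ {y ys} xs → filter P? xs ≡ y ∷ ys →
              ∃[ us ] ∃[ vs ] xs ≡ us ++ y ∷ vs × (∀ {x} → x ∈ us → ¬ P x) × P y × filter P? vs ≡ ys
  filter-≡∷ (x ∷ xs) eq with P? x
  filter-≡∷ (x ∷ xs) refl | yes px = [] , xs , refl , (λ ()) , px , refl
  filter-≡∷ (x ∷ xs) eq   | no ¬px with filter-≡∷ xs eq
  ... | us , vs , refl , ¬us , py , eq′ =
    x ∷ us , vs , refl , (λ { (here refl) → ¬px ; (there x∈) → ¬us x∈ }) , py , eq′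

filter-cong-∈ : ∀ {A : Set} {P Q : A → Set} (P? : Decidable P) (Q? : Decidable Q) xs →
                (∀ {x} → x ∈ xs → P x → Q x) → (∀ {x} → x ∈ xs → Q x → P x) →
                filter P? xs ≡ filter Q? xs
filter-cong-∈ P? Q? []       to from = refl
filter-cong-∈ P? Q? (x ∷ xs) to from with P? x | Q? x
... | yes p | yes q = cong (x ∷_) (filter-cong-∈ P? Q? xs (to ∘ there) (from ∘ there))
... | yes p | no ¬q = contradiction (to (here refl) p) ¬q
... | no ¬p | yes q = contradiction (from (here refl) q) ¬p
... | no ¬p | no ¬q = filter-cong-∈ P? Q? xs (to ∘ there) (from ∘ there)

branch : ∀ {n} → ℕ → Rotation n → Dart n → Tree
branch k σ a = relabel (outvᵤ σ a) (ρ-rec k (Π σ a))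

ρ-rec-unfold : ∀ {n} k (σ : Rotation n) c → ρ-rec (suc k) (rooted σ (just c)) ≡
  node (length (outerVertices σ c))
       (map (branch k (cut (outerCorners σ c) σ)) (reverse (outerCorners σ c)))
ρ-rec-unfold k σ c = refl

-- Rotations are defined on all darts, including those of other components. A set K closed under α
-- and the rotation is a union of components, and agreement on it is all that the recursion can see.
record Agree {A : Set} (K : A → Set) (f g : A → A) : Set where
  field
    closed : ∀ {x} → K x → K (f x)
    agrees : ∀ {x} → K x → f x ≡ g x

open Agree

module _ {n : ℕ} {K : Dart n → Set} where

  orbit-agree : ∀ {f g x} → Agree K f g → K x → orbit f x ≡ orbit g x
  orbit-agree {f} {g} {x} ag kx = cong (λ ys → x ∷ takeWhile (λ y → ¬? (y ≟ x)) ys)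
    (trans (cong (λ y → iterate f y (n * 2)) (agrees ag kx))
           (iterates (n * 2) (subst K (agrees ag kx) (closed ag kx))))
    where
    iterates : ∀ m {y} → K y → iterate f y m ≡ iterate g y m
    iterates zero    ky = refl
    iterates (suc m) {y} ky = cong (y ∷_)
      (trans (cong (λ y → iterate f y m) (agrees ag ky))
             (iterates m (subst K (agrees ag ky) (closed ag ky))))

  orbit-closed : ∀ {f x y} → (∀ {x} → K x → K (f x)) → K x → y ∈ orbit f x → K y
  orbit-closed cl kx y∈ = proj₁ (chain-All cl kx (proj₂ (∈-orbit⇒chain y∈)))

  agree-detach : ∀ {σ τ a b} → K a → K b → Agree K σ τ → Agree K (detach a b σ) (detach a b τ)
  agree-detach {σ} {τ} {a} {b} ka kb ag = record
    { closed = λ {x} kx → swap-closed (σ x) (closed ag kx)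
    ; agrees = λ kx → cong (swap a b) (agrees ag kx)
    }
    where
    swap-closed : ∀ x → K x → K (swap a b x)
    swap-closed x kx with swap-view a b x
    ... | left _ eq    = subst K (sym eq) kb
    ... | right _ eq   = subst K (sym eq) ka
    ... | other _ _ eq = subst K (sym eq) kx

  agree-isolate : ∀ {σ τ d} → K d → Agree K σ τ → Agree K (isolate d σ) (isolate d τ)
  agree-isolate {σ} {τ} {d} kd ag =
    subst (λ y → Agree K (isolate d σ) (detach d y τ)) (agrees ag kd)
      (agree-detach kd (closed ag kd) ag)

  agree-cut : ∀ cs {σ τ} → All K cs → Agree K σ τ → Agree K (cut cs σ) (cut cs τ)
  agree-cut []           ks             ag = ag
  agree-cut (a ∷ [])     ks             ag = ag
  agree-cut (a ∷ b ∷ cs) (ka ∷ kb ∷ ks) ag = agree-cut (b ∷ cs) (kb ∷ ks) (agree-detach ka kb ag)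

  module _ (K-α : ∀ {x} → K x → K (α x)) where

    agree-next : ∀ {σ τ} → Agree K σ τ → Agree K (next σ) (next τ)
    agree-next ag = record { closed = λ kx → closed ag (K-α kx) ; agrees = λ kx → agrees ag (K-α kx) }

    face-closed : ∀ {σ τ x y} → Agree K σ τ → K x → y ∈ face σ x → K y
    face-closed ag = orbit-closed (closed (agree-next ag))

    outerVertices-agree : ∀ {σ τ c} → Agree K σ τ → K c → outerVertices σ c ≡ outerVertices τ c
    outerVertices-agree {σ} {τ} {c} ag kc =
      trans (dedup (All.tabulate (face-closed ag kc)))
            (cong (deduplicate (sameVertex? τ)) (orbit-agree (agree-next ag) kc))
      where
      dedup : ∀ {xs} → All K xs → deduplicate (sameVertex? σ) xs ≡ deduplicate (sameVertex? τ) xs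
      dedup []                  = refl
      dedup {x ∷ xs} (kx ∷ kxs) = cong₂ (λ o ys → x ∷ filter (λ y → ¬? (y ∈? o)) ys)
        (orbit-agree ag kx) (dedup kxs)

    outvᵤ-agree : ∀ {σ τ c} → Agree K σ τ → K c → outvᵤ σ c ≡ outvᵤ τ c
    outvᵤ-agree ag kc = cong₂ (λ o ys → length (filter (λ y → ¬? (y ∈? o)) ys))
      (orbit-agree ag kc) (outerVertices-agree ag kc)

    outerCorners-agree : ∀ {σ τ c} → Agree K σ τ → K c → outerCorners σ c ≡ outerCorners τ c
    outerCorners-agree ag kc = cong₂ (λ o ys → filter (_∈? o) ys)
      (orbit-agree (agree-next ag) kc) (orbit-agree ag kc)

    outerCorners-closed : ∀ {σ τ c} → Agree K σ τ → K c → All K (outerCorners σ c)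
    outerCorners-closed {σ} {τ} {c} ag kc = All.tabulate λ x∈ →
      orbit-closed (closed ag) kc (proj₁ (∈-filter⁻ (_∈? face σ c) {xs = orbit σ c} x∈))

    Π-agree : ∀ {σ τ c} → Agree K σ τ → K c →
              Agree K (Rooted.rotation (Π σ c)) (Rooted.rotation (Π τ c)) ×
              Rooted.root (Π σ c) ≡ Rooted.root (Π τ c) ×
              (∀ {r} → Rooted.root (Π σ c) ≡ just r → K r)
    Π-agree {σ} {τ} {c} ag kc =
      agree-isolate (K-α kc) ag₁ ,
      cong (λ r → if does (r ≟ α c) then nothing else just r) (agrees ag₁ (K-α kc)) ,
      root-closed (closed ag₁ (K-α kc))
      where
      ag₁ = agree-isolate kc ag
      root-closed : ∀ {x r} → K x → (if does (x ≟ α c) then nothing else just x) ≡ just r → K r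
      root-closed {x} kx eq with does (x ≟ α c)
      root-closed kx refl | false = kx

    ρ-rec-agree : ∀ k (M N : Rooted n) → Agree K (Rooted.rotation M) (Rooted.rotation N) →
                  Rooted.root M ≡ Rooted.root N → (∀ {c} → Rooted.root M ≡ just c → K c) →
                  ρ-rec k M ≡ ρ-rec k N
    branch-agree : ∀ k {σ τ a} → Agree K σ τ → K a → branch k σ a ≡ branch k τ a
    branches-agree : ∀ k {σ τ cs ds} → Agree K σ τ → All K cs → cs ≡ ds →
                     map (branch k (cut cs σ)) (reverse cs) ≡ map (branch k (cut ds τ)) (reverse ds)

    ρ-rec-agree zero    M                   N            ag eq   kr = refl
    ρ-rec-agree (suc k) (rooted σ nothing)  (rooted τ _) ag refl kr = refl
    ρ-rec-agree (suc k) (rooted σ (just c)) (rooted τ _) ag refl kr =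
      trans (ρ-rec-unfold k σ c) (trans
        (cong₂ node (cong length (outerVertices-agree ag (kr refl)))
          (branches-agree k ag (outerCorners-closed ag (kr refl)) (outerCorners-agree ag (kr refl))))
        (sym (ρ-rec-unfold k τ c)))

    branch-agree k {σ} {τ} {a} ag ka with Π-agree ag ka
    ... | agΠ , eq , kΠ = cong₂ relabel (outvᵤ-agree ag ka) (ρ-rec-agree k (Π σ a) (Π τ a) agΠ eq kΠ)

    branches-agree k {cs = cs} ag kcs refl =
      map-cong-local (All-reverse (All.map (branch-agree k (agree-cut cs kcs ag)) kcs))

-- Outer corners of the root vertex, and the cut at two consecutive ones

module _ {n : ℕ} {τ : Rotation n} (inj : Injective _≡_ _≡_ τ) where

  outerCorners-head : ∀ c → ∃[ t ] outerCorners τ c ≡ c ∷ filter (_∈? face τ c) t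
  outerCorners-head c with orbit-tail inj c
  ... | t , eq , _ = t , trans (cong (filter (_∈? face τ c)) eq)
                                    (filter-accept (_∈? face τ c) {c} {t} (here refl))

  outerCorners-unique : ∀ c → Unique (outerCorners τ c)
  outerCorners-unique c with orbit-tail inj c
  ... | _ , eq , _ , u = Unique.filter⁺ (_∈? face τ c) (subst Unique (sym eq) u)

-- The induction step along the outer corners: the piece of c has become a one-corner component, and
-- the piece of d starts over with one corner less.
record CornerSplit {n} (τ : Rotation n) (c d : Dart n) (ds : List (Dart n)) : Set where
  field
    planar₁        : Planar (detach c d τ)
    separated      : ¬ Conn (detach c d τ) c d
    X₁ X₂          : List (Dart n)
    face≡          : face τ c ≡ c ∷ X₁ ++ d ∷ X₂
    face₂          : face (detach c d τ) d ≡ d ∷ X₂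
    corners₁       : outerCorners (detach c d τ) c ≡ c ∷ []
    corners₂       : outerCorners (detach c d τ) d ≡ d ∷ ds

split-corner : ∀ {n} {τ : Rotation n} {c d ds} → Planar τ → outerCorners τ c ≡ c ∷ d ∷ ds →
               CornerSplit τ c d ds
split-corner {n} {τ} {c} {d} {ds} pl eq
  with orbit-tail (Planar.injective pl) c | orbit-tail (next-injective τ (Planar.injective pl)) c
... | t , o≡ , oc , ou | s , f≡ , fc , fu
  with filter-≡∷ (_∈? face τ c) t (∷-injectiveʳ (trans (trans (sym
         (filter-accept (_∈? face τ c) {c} {t} (here refl))) (cong (filter (_∈? face τ c)) (sym o≡))) eq))
... | p , q , refl , p∉ , d∈ , q≡ with ∈-∃++ (∈-resp f≡ d∈)
... | [] , X₂ , refl = ⊥-elim (head∉tail ou (∈-++⁺ʳ p (here refl)))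
... | _ ∷ X₁ , X₂ , refl = record
  { planar₁   = planar-detach c≢d d∈v pl
  ; separated = sep
  ; X₁ = X₁ ; X₂ = X₂
  ; face≡     = f≡
  ; face₂     = face₂
  ; corners₁  = trans (cong₂ (λ o f → filter (_∈? f) o) (cycle⇒orbit (proj₁ oc′) (proj₁ ou′)) face₁)
      (trans (filter-accept (_∈? (c ∷ X₁)) {c} {p} (here refl))
        (cong (c ∷_) (filter-none (_∈? (c ∷ X₁)) (All.tabulate λ x∈ x∈X → p∉ x∈ (∈-resp (sym f≡) (∈-++⁺ˡ x∈X))))))
  ; corners₂  = trans (cong₂ (λ o f → filter (_∈? f) o) orbit₂ face₂)
      (trans (filter-accept (_∈? (d ∷ X₂)) {d} {q} (here refl))
        (cong (d ∷_) (trans (filter-cong-∈ (_∈? (d ∷ X₂)) (_∈? face τ c) q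
           (λ _ x∈ → ∈-resp (sym f≡) (∈-++⁺ʳ (c ∷ X₁) x∈))
           (λ x∈q x∈f → outer₂ x∈q (∈-++⁻ (c ∷ X₁) (∈-resp f≡ x∈f)))) q≡)))
  }
  where
  c≢d : c ≢ d
  c≢d refl = head∉tail ou (∈-++⁺ʳ p (here refl))
  d∈v : d ∈ orbit τ c
  d∈v = ∈-resp (sym o≡) (there (∈-++⁺ʳ p (here refl)))
  sep = jordan pl c≢d d∈v d∈
  oc′ = split-cycle (Planar.injective pl) c d oc ou
  ou′ = unique-++⁻ (c ∷ p) ou
  fc′ = split-cycle (next-injective τ (Planar.injective pl)) c d fc fu
  fu′ = unique-++⁻ (c ∷ X₁) fu
  orbit₂ = cycle⇒orbit (proj₂ oc′) (proj₁ (proj₂ ou′))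
  face₁ = cycle⇒orbit (proj₁ fc′) (proj₁ fu′)
  face₂ = cycle⇒orbit (proj₂ fc′) (proj₁ (proj₂ fu′))
  -- A later corner of the vertex lying on the part of the face that now belongs to c would connect
  -- the two pieces.
  outer₂ : ∀ {x} → x ∈ q → x ∈ c ∷ X₁ ⊎ x ∈ d ∷ X₂ → x ∈ d ∷ X₂
  outer₂ x∈q (inj₂ x∈)  = x∈
  outer₂ x∈q (inj₁ x∈) = contradiction
    (face⇒conn (∈-resp (sym face₁) x∈) ◅◅
     conn-sym (vertex⇒conn (∈-resp (sym orbit₂) (there x∈q)))) sep

-- For the isolation of a dart that is already alone, which changes nothing but equals the old
-- rotation only pointwise.
planar-cong : ∀ {n} {σ τ : Rotation n} → (∀ x → σ x ≡ τ x) → Planar σ → Planar τ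
planar-cong {σ = σ} {τ} eq p = record
  { injective = λ {x} {y} e → Planar.injective p (trans (eq x) (trans e (sym (eq y))))
  ; counted   = record
    { vertices-independent = AllPairs.map (λ y∉ y∈ → y∉ (∈-resp (sym (orbit-agree ag tt)) y∈))
                               (Counted.vertices-independent N)
    ; faces-independent    = AllPairs.map (λ y∉ y∈ → y∉ (∈-resp (sym (orbit-agree (agree-next (λ _ → tt) ag) tt)) y∈))
                               (Counted.faces-independent N)
    ; generating           = λ x → let l , l∈ , c = Counted.generating N x in l , l∈ , conn c
    }
  ; genus0    = Planar.genus0 p
  }
  where
  N = Planar.counted p
  ag : Agree (λ _ → ⊤) σ τ
  ag = record { closed = λ _ → tt ; agrees = λ _ → eq _ }
  conn : ∀ {x y} → Conn σ x y → Conn τ x y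
  conn = Eq.map (Sum.map (λ e → trans e (eq _)) id)

planar-isolate : ∀ {n} {σ : Rotation n} d → Planar σ → Planar (isolate d σ)
planar-isolate {σ = σ} d p with d ≟ σ d
... | no d≢   = planar-detach d≢ (∈-orbit-step (Planar.injective p) (here refl)) p
... | yes d≡ = planar-cong (λ x → sym (trans (cong (λ e → swap d e (σ x)) (sym d≡)) (swap-same d (σ x)))) p

-- `ρ` cuts at all corners before recursing, whereas the walk meets the components one at a time;
-- the cuts still to come do not affect the component at hand.
agree-cut-outside : ∀ {n} {K : Dart n → Set} {σ τ : Rotation n} cs → All (λ a → ¬ K a) cs →
                    Agree K σ τ → Agree K (cut cs σ) τ
agree-cut-outside []           ¬ks ag = ag
agree-cut-outside (a ∷ [])     ¬ks ag = ag
agree-cut-outside {K = K} {σ} {τ} (a ∷ b ∷ cs) (¬ka ∷ ¬kb ∷ ¬ks) ag =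
  agree-cut-outside (b ∷ cs) (¬kb ∷ ¬ks) record
    { closed = λ kx → subst K (sym (fixed (closed ag kx))) (closed ag kx)
    ; agrees = λ kx → trans (fixed (closed ag kx)) (agrees ag kx)
    }
  where
  open Agree
  fixed : ∀ {x} → K x → swap a b x ≡ x
  fixed kx = swap-other a b (λ { refl → ¬ka kx }) (λ { refl → ¬kb kx })

-- The contour walk

steps-+ : ∀ {n} (g : Dart n) j k s → steps g (j + k) s ≡ steps g k (steps g j s)
steps-+ g zero    k s = refl
steps-+ g (suc j) k s = steps-+ g j k (step g s)

open State

setLabel-on : ∀ {n} {σ : Rotation n} {v x a ℓ} → x ∈ orbit σ v → setLabel σ v a ℓ x ≡ a
setLabel-on {σ = σ} {v} {x} {a} {ℓ} x∈ =
  cong (λ b → if b then a else ℓ x) (dec-true (sameVertex? σ v x) x∈)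

setLabel-off : ∀ {n} {σ : Rotation n} {v x a ℓ} → x ∉ orbit σ v → setLabel σ v a ℓ x ≡ ℓ x
setLabel-off {σ = σ} {v} {x} {a} {ℓ} x∉ =
  cong (λ b → if b then a else ℓ x) (dec-false (sameVertex? σ v x) x∉)

enter : ∀ {n} → State n → Dart n → Dart n → ℕ → State n
enter s c z a = record
  { rotation = σ′
  ; label    = setLabel σ′ (α c) a (label s)
  ; visited  = edge c ∷ visited s
  ; position = next σ′ c
  }
  where σ′ = detach (rotation s c) z (rotation s)

module _ {n : ℕ} (g : Dart n) where

  private
    both-steps : State n → Dart n → Bool → State n
    both-steps s z b = if b then record s { position = next (rotation s) (position s) }
                            else enter s (position s) z (outvᵤ (detach (position s) z (rotation s)) (position s))

  step-new : ∀ s {c z} → position s ≡ c → edge c ∉ visited s → nextOuter (rotation s) g c ≡ z →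
             step g s ≡ enter s c z (outvᵤ (detach c z (rotation s)) c)
  step-new s {c} {z} refl e∉ eq = trans
    (cong (both-steps s (nextOuter (rotation s) g c)) (dec-false (edge c ∈ᵉ? visited s) e∉))
    (cong (λ z → enter s c z (outvᵤ (detach c z (rotation s)) c)) eq)

  step-old : ∀ s {c} → position s ≡ c → edge c ∈ visited s →
             step g s ≡ record s { position = next (rotation s) c }
  step-old s {c} refl e∈ =
    cong (both-steps s (nextOuter (rotation s) g c)) (dec-true (edge c ∈ᵉ? visited s) e∈)

  -- The walk makes `n * 2` steps, and the trail is shown to have at most that many. Any surplus
  -- steps turn around a face that is entirely visited.
  idle : ∀ m s {ws} → Chain (next (rotation s)) g (g ∷ ws) g → position s ∈ g ∷ ws →
         All (λ x → edge x ∈ visited s) (g ∷ ws) →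
         rotation (steps g m s) ≡ rotation s × label (steps g m s) ≡ label s
  idle zero    s c p∈ vis = refl , refl
  idle (suc m) s c p∈ vis rewrite step-old s refl (All.lookup vis p∈) =
    idle m (record s { position = next (rotation s) (position s) }) c (cycle-closed c p∈) vis

  -- The darts in K form a map with rotation τ, which the current map contains
  -- between the corners c and z of a vertex; c and z lie on the outer face, and
  -- the part of this face from z on is outside of K.
  record Site (K : Dart n → Set) (τ : Rotation n) (s : State n) (c z : Dart n) : Set where
    field
      K-α          : ∀ {x} → K x → K (α x)
      K-τ          : ∀ {x} → K x → K (τ x)
      K-c          : K c
      -- The case z ≡ c is that of a K filling the whole vertex; the swap is then trivial.
      K-z          : K z → z ≡ c
      planar       : Planar τ
      injective    : Injective _≡_ _≡_ (rotation s)
      rotation-on  : ∀ {x} → K x → rotation s x ≡ swap c z (τ x)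
      at           : position s ≡ c
      unvisited    : ∀ {x} → K x → edge x ∉ visited s
      rest         : List (Dart n)
      rest-chain   : Chain (next (rotation s)) z rest c
      rest-outside : ∀ {x} → x ∈ rest → ¬ K x
      -- `nextOuter` tests membership in the face of g, which therefore has to be the face running
      -- through c.
      g∈           : g ∈ c ∷ rest

  -- The trail is a chain of the final rotation, not of the intermediate ones: the part already
  -- walked is left alone afterwards. This allows it to serve as part of `rest` for the next
  -- component.
  record Traversal (K : Dart n → Set) (s : State n) (c z : Dart n) : Set where
    field
      trail            : List (Dart n)
      after            : State n
      steps-after      : steps g (length trail) s ≡ after
      position-after   : position after ≡ z
      injective-after  : Injective _≡_ _≡_ (rotation after)
      rotation-outside : ∀ {x} → ¬ K x → rotation after x ≡ rotation s x
      label-outside    : ∀ {x} → ¬ K x → label after x ≡ label s x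
      trail-chain      : Chain (next (rotation after)) c trail z
      trail-unique     : Unique trail
      trail-inside     : ∀ {x} → x ∈ trail → K x
      trail-visited    : ∀ {x} → x ∈ trail → edge x ∈ visited after
      visited-grows    : ∀ {e} → e ∈ visited s → e ∈ visited after
      visited-inside   : ∀ {e} → e ∈ visited after → e ∈ visited s ⊎ (∃[ x ] K x × edge x ≡ e)

  -- Both sides have the same fuel, so the reading and the recursion reach depth zero together.
  Reads : Rotation n → (Dart n → ℕ) → Rotation n → ℕ → Dart n → Set
  Reads σ ℓ τ k a = readTree σ ℓ k (ℓ (α a)) (drop 1 (orbit σ (α a))) ≡ branch k τ a

  -- `reads` admits every rotation and labeling that coincide on K with those reached here, so it
  -- survives the rest of the walk.
  record Explored (K : Dart n → Set) (τ : Rotation n) (s : State n) (c z : Dart n)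
                  (k : ℕ) (cs : List (Dart n)) : Set where
    field
      traversal : Traversal K s c z
    open Traversal traversal public
    field
      c∈trail       : c ∈ trail
      label-c       : label after c ≡ label s c
      corners-chain : Chain (rotation after) c cs z
      reads         : ∀ {σ ℓ} → (∀ {x} → K x → σ x ≡ rotation after x) →
                      (∀ {x} → K x → ℓ x ≡ label after x) → All (Reads σ ℓ (cut cs τ) k) cs

  -- K is a mere predicate; the list es bounds the number of its edges, on which the induction runs.
  Explorable : ℕ → Set₁
  Explorable k = ∀ {K τ s c z} cs es → Site K τ s c z → (∀ {x} → K x → edge x ∈ es) →
                 length es ≤ suc k → outerCorners τ c ≡ cs → Explored K τ s c z k cs

  module AtSite {K τ s c z} (site : Site K τ s c z) where
    open Site site

    σ : Rotation n
    σ = rotation s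

    inj : Injective _≡_ _≡_ τ
    inj = Planar.injective planar

    ≢z : ∀ {x} → K x → x ≢ c → x ≢ z
    ≢z kx x≢c refl = x≢c (K-z kx)

    -- Applied to τ for the vertex and to `next τ` for the face: the swap opens the cycle at c and
    -- lets it arrive at z.
    into-σ : ∀ {f h : Dart n → Dart n} → (∀ {x} → K x → K (f x)) → (∀ {x} → K x → h x ≡ swap c z (f x)) →
             ∀ {ws} → Chain f c (c ∷ ws) c → Unique (c ∷ ws) → Chain h c (c ∷ ws) z
    into-σ {h = h} K-f h≡ ch u = subst (Chain h c _) (swap-left c z)
      (chain-redirect (swap c z) ch (λ v∈ → h≡ (in-K v∈)) λ v∈ →
        let v≢c = λ { refl → head∉tail u v∈ } in swap-other c z v≢c (≢z (in-K (there v∈)) v≢c))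
      where in-K = proj₂ (chain-All {P = K} K-f K-c ch)

    vertex-chain : ∃[ ws ] orbit τ c ≡ c ∷ ws × Unique (c ∷ ws) × Chain σ c (c ∷ ws) z
    vertex-chain with orbit-tail inj c
    ... | ws , eq , ch , u = ws , eq , u , into-σ K-τ rotation-on ch u

    face-chain : Chain (next σ) c (face τ c) z
    face-chain with orbit-tail (next-injective τ inj) c
    ... | ws , eq , ch , u = subst (λ l → Chain (next σ) c l z) (sym eq)
      (into-σ (K-τ ∘ K-α) (rotation-on ∘ K-α) ch u)

    K-vertex : ∀ {x} → x ∈ orbit τ c → K x
    K-vertex = orbit-closed K-τ K-c

    K-face : ∀ {x} → x ∈ face τ c → K x
    K-face = orbit-closed (K-τ ∘ K-α) K-c

    outer-cycle : Chain (next σ) c (face τ c ++ rest) c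
    outer-cycle = chain-++ face-chain rest-chain

    outer : ∀ {x} → (x ∈ face τ c ++ rest → x ∈ face σ g) × (x ∈ face σ g → x ∈ face τ c ++ rest)
    outer = ∈-cycle⇔∈-orbit (next-injective σ injective) outer-cycle (g∈face g∈)
      where
      g∈face : g ∈ c ∷ rest → g ∈ face τ c ++ rest
      g∈face (here refl) = here refl
      g∈face (there g∈)  = ∈-++⁺ʳ (face τ c) g∈

    z-outer : z ∈ face σ g
    z-outer = ∈-orbit-trans (next-injective σ injective) (proj₁ outer (here refl))
                (chain⇒∈-orbit (next-injective σ injective) face-chain)

    -- After c, the darts at the vertex of a one-corner component are not on its own outer face, and
    -- the rest of the current outer face avoids K; hence nothing qualifies before z.
    nextOuter-z : outerCorners τ c ≡ c ∷ [] → nextOuter σ g c ≡ z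
    nextOuter-z corners with vertex-chain
    ... | ws , o≡ , u , ch = by-cases (z ≟ c)
      where
      ws-inner : ∀ {x} → x ∈ ws → x ∉ face σ g
      ws-inner x∈ x∈f with ∈-++⁻ (face τ c) (proj₂ outer x∈f)
      ... | inj₂ x∈rest = rest-outside x∈rest (K-vertex (∈-resp (sym o≡) (there x∈)))
      ... | inj₁ x∈face = filter-≡[] (_∈? face τ c)
        (∷-injectiveʳ (trans (sym (filter-accept (_∈? face τ c) {c} {ws} (here refl)))
          (trans (cong (filter (_∈? face τ c)) (sym o≡)) corners))) x∈ x∈face
      none : filter (_∈? face σ g) ws ≡ []
      none = filter-none (_∈? face σ g) (All.tabulate ws-inner)
      from : List (Dart n) → Dart n
      from o = fromMaybe c (head (filter (_∈? face σ g) (drop 1 o)))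
      by-cases : Dec (z ≡ c) → nextOuter σ g c ≡ z
      -- No other corner qualifies, and the default value c of `nextOuter` is z.
      by-cases (yes refl) = trans (cong from (cycle⇒orbit ch u)) (cong (fromMaybe c ∘ head) none)
      by-cases (no z≢c) with orbit-prefix ch u z≢c
      ... | vs , eq = trans (cong from eq) (cong (fromMaybe c ∘ head)
        (trans (filter-++ (_∈? face σ g) ws (z ∷ vs))
          (cong₂ _++_ none (filter-accept (_∈? face σ g) {z} {vs} z-outer))))

    z-predecessor : ∃[ w ] K w × σ w ≡ z
    z-predecessor with vertex-chain
    ... | ws , o≡ , _ , ch with chain-predecessor ch (λ ())
    ... | w , w∈ , eq = w , K-vertex (∈-resp (sym o≡) w∈) , eq

    -- The walk computes its label in `detach c z σ`. On K this is the component itself, hence the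
    -- label is the one given by `ρ`.
    local : Agree K (detach c z σ) τ
    local = record
      { closed = λ kx → subst K (sym (eq kx)) (K-τ kx)
      ; agrees = eq
      }
      where
      eq : ∀ {x} → K x → detach c z σ x ≡ τ x
      eq kx = trans (cong (swap c z) (rotation-on kx)) (swap-involutive c z _)

  -- To be read with t = τ c and y = τ x: the detachment made by the walk in the glued rotation
  -- amounts to isolating c in the component. For a bridge t is c, and the detachment is trivial.
  swap-conjugate : ∀ {c z t y : Dart n} → (t ≢ c → t ≢ z) → (y ≢ c → y ≢ z) → y ≢ t →
                   swap (swap c z t) z (swap c z y) ≡ swap c t y
  swap-conjugate {c} {z} {t} {y} t≢ y≢ y≢t = by-cases (t ≟ c) (y ≟ c)
    where
    open ≡-Reasoning
    by-cases : Dec (t ≡ c) → Dec (y ≡ c) → swap (swap c z t) z (swap c z y) ≡ swap c t y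
    by-cases (yes refl) _ = begin
      swap (swap c z c) z (swap c z y)  ≡⟨ cong (λ a → swap a z (swap c z y)) (swap-left c z) ⟩
      swap z z (swap c z y)             ≡⟨ swap-same z _ ⟩
      swap c z y                        ≡⟨ swap-other c z y≢t (y≢ y≢t) ⟩
      y                                 ≡⟨ swap-same c y ⟨
      swap c c y                        ∎
    by-cases (no t≢c) (yes refl) = begin
      swap (swap c z t) z (swap c z c)  ≡⟨ cong₂ (λ a b → swap a z b) (swap-other c z t≢c (t≢ t≢c)) (swap-left c z) ⟩
      swap t z z                        ≡⟨ swap-right t z ⟩
      t                                 ≡⟨ swap-left c t ⟨
      swap c t c                        ∎
    by-cases (no t≢c) (no y≢c) = begin
      swap (swap c z t) z (swap c z y)  ≡⟨ cong₂ (λ a b → swap a z b) (swap-other c z t≢c (t≢ t≢c)) (swap-other c z y≢c (y≢ y≢c)) ⟩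
      swap t z y                        ≡⟨ swap-other t z y≢t (y≢ y≢c) ⟩
      y                                 ≡⟨ swap-other c t y≢c y≢t ⟨
      swap c t y                        ∎

-- A one-corner component: entering its root edge

module Enter {n : ℕ} (g : Dart n) {K τ s c z} (site : Site g K τ s c z)
             (corners : outerCorners τ c ≡ c ∷ []) where
  open Site site
  open AtSite g site

  -- τ₁ and τ₂ are the two stages of the deletion in `Π`; σ′ is the rotation of the walk after its
  -- step along c.
  τ₁ τ₂ σ′ : Rotation n
  τ₁ = isolate c τ
  τ₂ = isolate (α c) τ₁
  σ′ = detach (σ c) z σ

  r : Dart n
  r = τ₁ (α c)

  K-αc : K (α c)
  K-αc = K-α K-c

  s₁ : State n
  s₁ = enter s c z (outvᵤ (detach c z σ) c)

  step-s : step g s ≡ s₁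
  step-s = step-new g s at (unvisited K-c) (nextOuter-z corners)

  inj₁-τ : Injective _≡_ _≡_ τ₁
  inj₁-τ = detach-injective τ c (τ c) inj

  inj₂-τ : Injective _≡_ _≡_ τ₂
  inj₂-τ = detach-injective τ₁ (α c) r inj₁-τ

  σ′-injective : Injective _≡_ _≡_ σ′
  σ′-injective = detach-injective σ (σ c) z injective

  τ₁-c : τ₁ c ≡ c
  τ₁-c = swap-right c (τ c)

  τ₂-αc : τ₂ (α c) ≡ α c
  τ₂-αc = swap-right (α c) r

  r≢c : r ≢ c
  r≢c eq = α≢ c (inj₁-τ (trans eq (sym τ₁-c)))

  τ₂-c : τ₂ c ≡ c
  τ₂-c = trans (cong (swap (α c) r) τ₁-c) (swap-other (α c) r (α≢ c ∘ sym) (r≢c ∘ sym))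

  agree₁ : Agree K τ₁ τ₁
  agree₁ = agree-isolate K-c record { closed = K-τ ; agrees = λ _ → refl }

  agree₂ : Agree K τ₂ τ₂
  agree₂ = agree-isolate K-αc agree₁

  σ′-c : σ′ c ≡ z
  σ′-c = swap-left (σ c) z

  σ′-on : ∀ {x} → K x → x ≢ c → σ′ x ≡ τ₁ x
  σ′-on {x} kx x≢c =
    trans (cong₂ (λ a y → swap a z y) (rotation-on K-c) (rotation-on kx))
      (swap-conjugate g (≢z (K-τ K-c)) (≢z (K-τ kx)) (x≢c ∘ inj))

  -- The swap moves only σ c and z, and the predecessors of both under σ lie in K.
  σ′-outside : ∀ {x} → ¬ K x → σ′ x ≡ σ x
  σ′-outside {x} ¬kx with z-predecessor
  ... | w , kw , σw≡z = swap-other (σ c) z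
    (λ eq → ¬kx (subst K (sym (injective eq)) K-c))
    (λ eq → ¬kx (subst K (injective (trans σw≡z (sym eq))) kw))

  σ′-αc : σ′ (α c) ≡ r
  σ′-αc = σ′-on K-αc (α≢ c)

  -- The new label stays within K and avoids c. For a loop this relies on the detachment, which
  -- separates α c from c.
  end-inside : ∀ {x} → x ∈ orbit σ′ (α c) → K x × x ≢ c
  end-inside = orbit-closed {K = λ x → K x × x ≢ c} closed′ (K-αc , α≢ c)
    where
    closed′ : ∀ {x} → K x × x ≢ c → K (σ′ x) × σ′ x ≢ c
    closed′ (kx , x≢c) =
      subst K (sym (σ′-on kx x≢c)) (Agree.closed agree₁ kx) ,
      λ eq → x≢c (inj₁-τ (trans (trans (sym (σ′-on kx x≢c)) eq) (sym τ₁-c)))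

  K₂ : Dart n → Set
  K₂ x = K x × x ≢ c × x ≢ α c

  K₂-edge : ∀ {x} → K₂ x → edge x ≢ edge c
  K₂-edge {x} (_ , x≢c , x≢αc) eq with same-edge x c eq
  ... | inj₁ x≡c  = x≢c x≡c
  ... | inj₂ x≡αc = x≢αc x≡αc

  inner-site : r ≢ α c → Site g K₂ τ₂ s₁ r (α c)
  inner-site r≢αc = record
    { K-α          = λ (kx , x≢c , x≢αc) → K-α kx ,
                       (λ eq → x≢αc (trans (sym (α-involutive _)) (cong α eq))) , x≢c ∘ α-injective
    ; K-τ          = λ (kx , x≢c , x≢αc) → Agree.closed agree₂ kx ,
                       (λ eq → x≢c (inj₂-τ (trans eq (sym τ₂-c)))) ,
                       (λ eq → x≢αc (inj₂-τ (trans eq (sym τ₂-αc))))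
    ; K-c          = Agree.closed agree₁ K-αc , r≢c , r≢αc
    ; K-z          = λ (_ , _ , αc≢αc) → contradiction refl αc≢αc
    ; planar       = planar-isolate (α c) (planar-isolate c planar)
    ; injective    = σ′-injective
    ; rotation-on  = λ {x} (kx , x≢c , _) → trans (σ′-on kx x≢c)
                       (trans (sym (swap-involutive (α c) r (τ₁ x))) (swap-comm (α c) r (τ₂ x)))
    ; at           = σ′-αc
    ; unvisited    = λ k₂x@(kx , _) → λ { (here eq) → K₂-edge k₂x eq ; (there e∈) → unvisited kx e∈ }
    -- Along α c the face goes to z, then through the old rest to c, and along c back to r.
    ; rest         = α c ∷ rest ++ c ∷ []
    ; rest-chain   = α c ∷ subst (λ y → Chain (next σ′) y (rest ++ c ∷ []) r) (sym next-αc)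
                       (chain-++ (chain-cong (λ x∈ → σ′-outside (¬K-α (rest-outside x∈))) rest-chain)
                                 (subst (Chain (next σ′) c (c ∷ [])) σ′-αc (c ∷ [])))
    ; rest-outside = λ { (here refl) (_ , _ , αc≢αc) → αc≢αc refl ; (there x∈) k₂x → outside (∈-++⁻ rest x∈) k₂x }
    ; g∈           = g∈′ g∈
    }
    where
    next-αc : next σ′ (α c) ≡ z
    next-αc = trans (cong σ′ (α-involutive c)) σ′-c
    ¬K-α : ∀ {x} → ¬ K x → ¬ K (α x)
    ¬K-α {x} ¬kx kαx = ¬kx (subst K (α-involutive x) (K-α kαx))
    outside : ∀ {x} → x ∈ rest ⊎ x ∈ c ∷ [] → ¬ K₂ x
    outside (inj₁ x∈)          (kx , _)      = rest-outside x∈ kx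
    outside (inj₂ (here refl)) (_ , c≢c , _) = c≢c refl
    g∈′ : g ∈ c ∷ rest → g ∈ r ∷ α c ∷ rest ++ c ∷ []
    g∈′ (here refl) = there (there (∈-++⁺ʳ rest (here refl)))
    g∈′ (there g∈)  = there (there (∈-++⁺ˡ g∈))

  -- Covers also the case where `Π` leaves a single vertex. The label a is free because `ρ`
  -- overwrites the root label of the subtree.
  record Inner (k : ℕ) : Set where
    field
      traversal     : Traversal g K₂ s₁ r (α c)
    open Traversal traversal public
    field
      children      : List (Dart n)
      children-chain  : Chain (rotation after) r children (α c)
      children-unique : Unique (α c ∷ children)
      children-inside : ∀ {x} → x ∈ children → K₂ x
      reads         : ∀ {σ ℓ} → (∀ {x} → K₂ x → σ x ≡ rotation after x) →
                      (∀ {x} → K₂ x → ℓ x ≡ label after x) → ∀ a →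
                      readTree σ ℓ k a children ≡ relabel a (ρ-rec k (Π τ c))

  Π-bare : r ≡ α c → Π τ c ≡ rooted τ₂ nothing
  Π-bare eq = cong (λ b → rooted τ₂ (if b then nothing else just r)) (dec-true (r ≟ α c) eq)

  Π-rooted : r ≢ α c → Π τ c ≡ rooted τ₂ (just r)
  Π-rooted neq = cong (λ b → rooted τ₂ (if b then nothing else just r)) (dec-false (r ≟ α c) neq)

  inner-bare : ∀ k → r ≡ α c → Inner k
  inner-bare k r≡αc = record
    { traversal = record
      { trail = [] ; after = s₁ ; steps-after = refl ; position-after = trans σ′-αc r≡αc
      ; injective-after = σ′-injective ; rotation-outside = λ _ → refl ; label-outside = λ _ → refl
      ; trail-chain = subst (Chain _ r []) r≡αc []
      ; trail-unique = [] ; trail-inside = λ () ; trail-visited = λ ()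
      ; visited-grows = id ; visited-inside = inj₁
      }
    ; children = [] ; children-chain = subst (Chain _ r []) r≡αc []
    ; children-unique = [] ∷ [] ; children-inside = λ ()
    ; reads = λ {σ} {ℓ} _ _ a → trans (leaf k σ ℓ a) (cong (λ M → relabel a (ρ-rec k M)) (sym (Π-bare r≡αc)))
    }
    where
    leaf : ∀ k σ ℓ a → readTree σ ℓ k a [] ≡ relabel a (ρ-rec k (rooted τ₂ nothing))
    leaf zero    σ ℓ a = refl
    leaf (suc k) σ ℓ a = refl

  inner-rooted : ∀ {k} es → (∀ {x} → K x → edge x ∈ es) → length es ≤ suc k →
                 (∀ j → k ≡ suc j → Explorable g j) → r ≢ α c → Inner k
  inner-rooted {k} es es⊇ es≤ smaller r≢αc = from k es₂≤ smaller
    where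
    open Site (inner-site r≢αc) using () renaming (K-c to K₂-r)
    e≢? : Decidable (_≢ edge c)
    e≢? e = ¬? (e Fin.≟ edge c)
    es₂ : List (Fin n)
    es₂ = filter e≢? es
    es₂⊇ : ∀ {x} → K₂ x → edge x ∈ es₂
    es₂⊇ k₂x = ∈-filter⁺ e≢? (es⊇ (proj₁ k₂x)) (K₂-edge k₂x)
    es₂≤ : length es₂ ≤ k
    -- The deleted edge leaves the list; this is where the induction on the number of edges
    -- descends.
    es₂≤ = s≤s⁻¹ (≤-trans (filter-notAll e≢? es (Any.map (λ eq neq → neq (sym eq)) (es⊇ K-c))) es≤)
    from : ∀ k → length es₂ ≤ k → (∀ j → k ≡ suc j → Explorable g j) → Inner k
    -- The list would be empty, yet it contains the edge of r.
    from zero es₂≤ _ with es₂ | es₂⊇ K₂-r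
    ... | []    | ()
    from zero () _ | _ ∷ _ | _
    from (suc j) es₂≤ smaller = record
      { traversal       = traversal
      ; children        = cs
      ; children-chain  = corners-chain
      ; children-unique = ∉⇒All≢ (λ αc∈ → proj₂ (proj₂ (cs-inside αc∈)) refl) ∷ outerCorners-unique inj₂-τ r
      ; children-inside = cs-inside
      ; reads           = λ {σ} {ℓ} σ≡ ℓ≡ a → trans
          (cong (node a) (map-cong-local (All-reverse (reads σ≡ ℓ≡))))
          (trans (cong (relabel a) (sym (ρ-rec-unfold j τ₂ r)))
                 (cong (λ M → relabel a (ρ-rec (suc j) M)) (sym (Π-rooted r≢αc))))
      }
      where
      cs : List (Dart n)
      cs = outerCorners τ₂ r
      open Explored (smaller j refl cs es₂ (inner-site r≢αc) es₂⊇ es₂≤ refl)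
      cs-inside : ∀ {x} → x ∈ cs → K₂ x
      cs-inside x∈ = AtSite.K-vertex g (inner-site r≢αc)
        (proj₁ (∈-filter⁻ (_∈? face τ₂ r) {xs = orbit τ₂ r} x∈))

-- A one-corner component: return along the root edge

module Exit {n : ℕ} (g : Dart n) {K τ s c z} (site : Site g K τ s c z)
            (corners : outerCorners τ c ≡ c ∷ []) {k} (inner : Enter.Inner g site corners k) where
  open Site site
  open AtSite g site using (σ; local)
  open Enter g site corners
  open Inner inner

  s₂ s₃ : State n
  s₂ = after
  s₃ = record s₂ { position = next (rotation s₂) (α c) }

  σ₂ : Rotation n
  σ₂ = rotation s₂

  ¬K₂ : ∀ {x} → ¬ K x → ¬ K₂ x
  ¬K₂ ¬kx (kx , _) = ¬kx kx

  ¬K₂-c : ¬ K₂ c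
  ¬K₂-c (_ , c≢c , _) = c≢c refl

  ¬K₂-αc : ¬ K₂ (α c)
  ¬K₂-αc (_ , _ , αc≢αc) = αc≢αc refl

  edge∈ : edge c ∈ visited s₂
  edge∈ = visited-grows (here refl)

  label-before : ∀ {x} → ¬ (K x × x ≢ c) → label s₂ x ≡ label s x
  label-before ¬in = trans (label-outside λ (kx , x≢c , _) → ¬in (kx , x≢c))
    (setLabel-off {σ = σ′} {v = α c} {ℓ = label s} λ x∈ → ¬in (end-inside x∈))

  next-αc : next σ₂ (α c) ≡ z
  next-αc = trans (cong σ₂ (α-involutive c)) (trans (rotation-outside ¬K₂-c) σ′-c)

  trail₃ : List (Dart n)
  trail₃ = c ∷ trail ++ α c ∷ []

  trail₃-cases : ∀ {x} {P : Dart n → Set} → P c → (∀ {x} → x ∈ trail → P x) → P (α c) →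
                 x ∈ trail₃ → P x
  trail₃-cases pc pt pα (here refl) = pc
  trail₃-cases pc pt pα (there x∈) with ∈-++⁻ trail x∈
  ... | inj₁ x∈t         = pt x∈t
  ... | inj₂ (here refl) = pα

  steps₃ : steps g (length trail₃) s ≡ s₃
  steps₃ = begin
    steps g (length (trail ++ α c ∷ [])) (step g s)   ≡⟨ cong₂ (steps g) (length-++ trail) step-s ⟩
    steps g (length trail + 1) s₁                     ≡⟨ steps-+ g (length trail) 1 s₁ ⟩
    step g (steps g (length trail) s₁)                ≡⟨ cong (step g) steps-after ⟩
    step g s₂                                         ≡⟨ step-old g s₂ position-after edge∈ ⟩
    s₃                                                ∎
    where open ≡-Reasoning

  explored : Explored g K τ s c z k (c ∷ [])
  explored = record
    { traversal = record
      { trail            = trail₃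
      ; after            = s₃
      ; steps-after      = steps₃
      ; position-after   = next-αc
      ; injective-after  = injective-after
      ; rotation-outside = λ ¬kx → trans (rotation-outside (¬K₂ ¬kx)) (σ′-outside ¬kx)
      ; label-outside    = λ ¬kx → label-before (¬kx ∘ proj₁)
      ; trail-chain      = c ∷ subst (λ y → Chain (next σ₂) y (trail ++ α c ∷ []) z)
          (sym (trans (rotation-outside ¬K₂-αc) σ′-αc))
          (subst (Chain (next σ₂) r (trail ++ α c ∷ [])) next-αc (chain-∷ʳ trail-chain))
      ; trail-unique     =
          ∉⇒All≢ (λ c∈ → c∉ (∈-++⁻ trail c∈)) ∷
          unique-++⁺ trail-unique ([] ∷ []) λ { x∈ (here refl) → ¬K₂-αc (trail-inside x∈) }
      ; trail-inside     = trail₃-cases {P = K} K-c (proj₁ ∘ trail-inside) K-αc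
      ; trail-visited    = trail₃-cases {P = λ x → edge x ∈ visited s₂} edge∈ trail-visited edge∈
      ; visited-grows    = visited-grows ∘ there
      ; visited-inside   = λ e∈ → inside (visited-inside e∈)
      }
    ; c∈trail       = here refl
    ; label-c       = label-before λ (_ , c≢c) → c≢c refl
    ; corners-chain = c ∷ subst (λ y → Chain σ₂ y [] z) (sym (trans (rotation-outside ¬K₂-c) σ′-c)) []
    ; reads         = λ σ≡ ℓ≡ → reads₃ σ≡ ℓ≡ ∷ []
    }
    where
    c∉ : ¬ (c ∈ trail ⊎ c ∈ α c ∷ [])
    c∉ (inj₁ c∈)        = ¬K₂-c (trail-inside c∈)
    c∉ (inj₂ (here eq)) = α≢ c (sym eq)
    inside : ∀ {e} → e ∈ edge c ∷ visited s ⊎ (∃[ x ] K₂ x × edge x ≡ e) →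
             e ∈ visited s ⊎ (∃[ x ] K x × edge x ≡ e)
    inside (inj₁ (here eq))           = inj₂ (c , K-c , sym eq)
    inside (inj₁ (there e∈))          = inj₁ e∈
    inside (inj₂ (x , (kx , _) , eq)) = inj₂ (x , kx , eq)
    reads₃ : ∀ {σ″ ℓ″} → (∀ {x} → K x → σ″ x ≡ σ₂ x) → (∀ {x} → K x → ℓ″ x ≡ label s₂ x) →
             Reads g σ″ ℓ″ τ k c
    reads₃ {σ″} {ℓ″} σ≡ ℓ≡ = begin
      readTree σ″ ℓ″ k (ℓ″ (α c)) (drop 1 (orbit σ″ (α c)))  ≡⟨ cong₂ (λ a o → readTree σ″ ℓ″ k a (drop 1 o)) label≡ orbit≡ ⟩
      readTree σ″ ℓ″ k (outvᵤ τ c) children                  ≡⟨ reads (σ≡ ∘ proj₁) (ℓ≡ ∘ proj₁) (outvᵤ τ c) ⟩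
      branch k τ c                                           ∎
      where
      open ≡-Reasoning
      label≡ : ℓ″ (α c) ≡ outvᵤ τ c
      -- The label was set on entry, and the inner walk keeps it because α c is outside of `K₂`.
      label≡ = trans (ℓ≡ K-αc) (trans (label-outside ¬K₂-αc)
        (trans (setLabel-on {σ = σ′} {v = α c} {ℓ = label s} (here refl)) (outvᵤ-agree K-α local K-c)))
      orbit≡ : orbit σ″ (α c) ≡ α c ∷ children
      orbit≡ = cycle⇒orbit
        (α c ∷ subst (λ y → Chain σ″ y children (α c))
          (sym (trans (σ≡ K-αc) (trans (rotation-outside ¬K₂-αc) σ′-αc)))
          (chain-cong (λ x∈ → σ≡ (proj₁ (children-inside x∈))) children-chain))
        children-unique

explore-one : ∀ {n} (g : Dart n) {K τ s c z k} es → Site g K τ s c z → (∀ {x} → K x → edge x ∈ es) →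
              length es ≤ suc k → (∀ j → k ≡ suc j → Explorable g j) →
              outerCorners τ c ≡ c ∷ [] → Explored g K τ s c z k (c ∷ [])
explore-one g {τ = τ} {c = c} {k = k} es site es⊇ es≤ smaller corners =
  Exit.explored g site corners (by-cases (r ≟ α c))
  where
  open Enter g site corners
  by-cases : Dec (r ≡ α c) → Inner k
  by-cases (yes r≡αc) = inner-bare k r≡αc
  by-cases (no r≢αc)  = inner-rooted es es⊇ es≤ smaller r≢αc

-- Several components: the first one, then the others

module Successive {n : ℕ} (g : Dart n) {K τ s c z d ds} (site : Site g K τ s c z)
                  (split : CornerSplit τ c d ds) where
  open Site site
  open AtSite g site using (σ; K-vertex; K-face; face-chain)
  open CornerSplit split

  τ₁ : Rotation n
  τ₁ = detach c d τ

  -- Taking the complement for `K₂` makes the two sets disjoint at once; that d belongs to it is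
  -- exactly `separated`.
  K₁ K₂ : Dart n → Set
  K₁ = Conn τ₁ c
  K₂ x = K x × ¬ K₁ x

  d-outer : d ∈ face τ c
  d-outer = ∈-resp (sym face≡) (there (∈-++⁺ʳ X₁ (here refl)))

  K-d : K d
  K-d = K-face d-outer

  agree₁ : Agree K τ₁ τ₁
  agree₁ = agree-detach K-c K-d record { closed = K-τ ; agrees = λ _ → refl }

  K₁⇒K : ∀ {x} → K₁ x → K x
  K₁⇒K = along K-c
    where
    along : ∀ {x y} → K x → Conn τ₁ x y → K y
    along kx ε                      = kx
    along kx (fwd (inj₁ refl) ◅ c~) = along (Agree.closed agree₁ kx) c~
    along kx (fwd (inj₂ refl) ◅ c~) = along (K-α kx) c~
    along kx (bwd (inj₂ refl) ◅ c~) = along (subst K (α-involutive _) (K-α kx)) c~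
    along kx (_◅_ {j = y} (bwd (inj₁ refl)) c~) = along (orbit-closed {f = τ₁} {x = τ₁ y} {y = y} (λ {v} → Agree.closed agree₁ {v}) kx y∈) c~
      where
      y∈ : y ∈ orbit τ₁ (τ₁ y)
      y∈ = ∈-orbit-sym (Planar.injective planar₁) {x = y} {y = τ₁ y}
             (∈-orbit-step (Planar.injective planar₁) {x = y} {y = y} (here refl))

  K₁-α : ∀ {x} → K₁ x → K₁ (α x)
  K₁-α k₁x = k₁x ◅◅ conn-α

  K₁-α⁻ : ∀ {x} → K₁ (α x) → K₁ x
  K₁-α⁻ k₁αx = k₁αx ◅◅ conn-sym conn-α

  K-α⁻ : ∀ {x} → K (α x) → K x
  K-α⁻ kαx = subst K (α-involutive _) (K-α kαx)

  near-d : ∀ {x} → Conn τ₁ d x → ¬ K₁ x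
  near-d d~x c~x = separated (c~x ◅◅ conn-sym d~x)

  z≡c-by : ∀ {x} → K x → x ≡ z → x ≡ c
  z≡c-by kx refl = K-z kx

  rotation-on₁ : ∀ {x} → K₁ x → σ x ≡ swap c d (τ₁ x)
  rotation-on₁ {x} k₁x = begin
    σ x                      ≡⟨ rotation-on (K₁⇒K k₁x) ⟩
    swap c z (τ x)           ≡⟨ swap-other c z τx≢c (τx≢c ∘ z≡c-by (K-τ (K₁⇒K k₁x))) ⟩
    τ x                      ≡⟨ swap-involutive c d (τ x) ⟨
    swap c d (τ₁ x)          ∎
    where
    open ≡-Reasoning
    -- Otherwise τ₁ would lead from x to d, across the cut.
    τx≢c : τ x ≢ c
    τx≢c eq = separated (subst (Conn τ₁ c) (trans (cong (swap c d) eq) (swap-left c d)) (k₁x ◅◅ conn-σ))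

  rotation-on₂ : ∀ {x} → K₂ x → σ x ≡ swap d z (τ₁ x)
  rotation-on₂ {x} (kx , ¬k₁x) = trans (rotation-on kx) (by-cases (swap-view c d (τ x)))
    where
    by-cases : SwapView c d (τ x) → swap c z (τ x) ≡ swap d z (τ₁ x)
    by-cases (left eq eq′)    = trans (trans (cong (swap c z) eq) (swap-left c z))
                                      (sym (trans (cong (swap d z) eq′) (swap-left d z)))
    by-cases (right _ eq′)    = contradiction (subst (Conn τ₁ c) (sym eq′) ε ◅◅ conn-sym conn-σ) ¬k₁x
    by-cases (other ≢c ≢d eq) = trans (swap-other c z ≢c (≢c ∘ z≡c-by (K-τ kx)))
                                      (sym (trans (cong (swap d z) eq) (swap-other d z ≢d (≢c ∘ z≡c-by (K-τ kx)))))

  site₁ : Site g K₁ τ₁ s c d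
  site₁ = record
    { K-α = K₁-α ; K-τ = λ k₁x → k₁x ◅◅ conn-σ ; K-c = ε
    ; K-z          = λ k₁d → contradiction k₁d separated
    ; planar       = planar₁
    ; injective    = injective
    ; rotation-on  = rotation-on₁
    ; at           = at
    ; unvisited    = unvisited ∘ K₁⇒K
    -- For the first component, the part of the local outer face from d on is outside as well.
    ; rest         = (d ∷ X₂) ++ rest
    ; rest-chain   = chain-++ (proj₂ (chain-split-at (c ∷ X₁)
                       (subst (λ l → Chain (next σ) c l z) face≡ face-chain))) rest-chain
    ; rest-outside = λ x∈ → outside (∈-++⁻ (d ∷ X₂) x∈)
    ; g∈           = g∈′ g∈
    }
    where
    outside : ∀ {x} → x ∈ d ∷ X₂ ⊎ x ∈ rest → ¬ K₁ x
    outside (inj₁ x∈) = near-d (face⇒conn (∈-resp (sym face₂) x∈))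
    outside (inj₂ x∈) = rest-outside x∈ ∘ K₁⇒K
    g∈′ : g ∈ c ∷ rest → g ∈ c ∷ (d ∷ X₂) ++ rest
    g∈′ (here refl) = here refl
    g∈′ (there g∈)  = there (∈-++⁺ʳ (d ∷ X₂) g∈)

  module _ {k} (e₁ : Explored g K₁ τ₁ s c d k (c ∷ [])) where
    module E₁ = Explored e₁

    site₂ : Site g K₂ τ₁ E₁.after d z
    site₂ = record
      { K-α          = λ (kx , ¬k₁x) → K-α kx , ¬k₁x ∘ K₁-α⁻
      ; K-τ          = λ (kx , ¬k₁x) → Agree.closed agree₁ kx , λ k₁ → ¬k₁x (k₁ ◅◅ conn-sym conn-σ)
      ; K-c          = K-d , separated
      ; K-z          = λ (kz , ¬k₁z) → contradiction (subst K₁ (sym (K-z kz)) ε) ¬k₁z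
      ; planar       = planar₁
      ; injective    = E₁.injective-after
      ; rotation-on  = λ k₂x → trans (E₁.rotation-outside (proj₂ k₂x)) (rotation-on₂ k₂x)
      ; at           = E₁.position-after
      ; unvisited    = λ (kx , ¬k₁x) e∈ → new kx ¬k₁x (E₁.visited-inside e∈)
      -- From z the old rest leads to c, and from there the finished trail of the first component
      -- leads to d.
      ; rest         = rest ++ E₁.trail
      ; rest-chain   = chain-++ (chain-cong (λ x∈ → E₁.rotation-outside (rest-outside x∈ ∘ K-α⁻ ∘ K₁⇒K)) rest-chain)
                                E₁.trail-chain
      ; rest-outside = λ x∈ → outside (∈-++⁻ rest x∈)
      ; g∈           = there (g∈′ g∈)
      }
      where
      new : ∀ {x} → K x → ¬ K₁ x → ¬ (edge x ∈ visited s ⊎ (∃[ y ] K₁ y × edge y ≡ edge x))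
      new kx ¬k₁x (inj₁ e∈)             = unvisited kx e∈
      new {x} kx ¬k₁x (inj₂ (y , k₁y , eq)) with same-edge x y (sym eq)
      ... | inj₁ refl = ¬k₁x k₁y
      ... | inj₂ refl = ¬k₁x (K₁-α k₁y)
      outside : ∀ {x} → x ∈ rest ⊎ x ∈ E₁.trail → ¬ K₂ x
      outside (inj₁ x∈) (kx , _)   = rest-outside x∈ kx
      outside (inj₂ x∈) (_ , ¬k₁x) = ¬k₁x (E₁.trail-inside x∈)
      g∈′ : g ∈ c ∷ rest → g ∈ rest ++ E₁.trail
      g∈′ (here refl) = ∈-++⁺ʳ rest E₁.c∈trail
      g∈′ (there g∈)  = ∈-++⁺ˡ g∈

    module _ (e₂ : Explored g K₂ τ₁ E₁.after d z k (d ∷ ds)) where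
      module E₂ = Explored e₂

      explored : Explored g K τ s c z k (c ∷ d ∷ ds)
      explored = record
        { traversal = record
          { trail            = E₁.trail ++ E₂.trail
          ; after            = E₂.after
          ; steps-after      = trans (cong (λ m → steps g m s) (length-++ E₁.trail))
              (trans (steps-+ g (length E₁.trail) (length E₂.trail) s)
                (trans (cong (steps g (length E₂.trail)) E₁.steps-after) E₂.steps-after))
          ; position-after   = E₂.position-after
          ; injective-after  = E₂.injective-after
          ; rotation-outside = λ ¬kx → trans (E₂.rotation-outside (¬kx ∘ proj₁)) (E₁.rotation-outside (¬kx ∘ K₁⇒K))
          ; label-outside    = λ ¬kx → trans (E₂.label-outside (¬kx ∘ proj₁)) (E₁.label-outside (¬kx ∘ K₁⇒K))
          ; trail-chain      = chain-++
              (chain-cong (λ x∈ → E₂.rotation-outside λ (_ , ¬k₁) → ¬k₁ (K₁-α (E₁.trail-inside x∈))) E₁.trail-chain)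
              E₂.trail-chain
          ; trail-unique     = unique-++⁺ E₁.trail-unique E₂.trail-unique
              λ x∈₁ x∈₂ → proj₂ (E₂.trail-inside x∈₂) (E₁.trail-inside x∈₁)
          ; trail-inside     = λ x∈ → Sum.[ K₁⇒K ∘ E₁.trail-inside , proj₁ ∘ E₂.trail-inside ] (∈-++⁻ E₁.trail x∈)
          ; trail-visited    = λ x∈ → Sum.[ E₂.visited-grows ∘ E₁.trail-visited , E₂.trail-visited ] (∈-++⁻ E₁.trail x∈)
          ; visited-grows    = E₂.visited-grows ∘ E₁.visited-grows
          ; visited-inside   = λ e∈ → Sum.[ (λ e∈ → Sum.map id (λ (x , k₁x , eq) → x , K₁⇒K k₁x , eq) (E₁.visited-inside e∈))
                                          , (λ (x , (kx , _) , eq) → inj₂ (x , kx , eq)) ] (E₂.visited-inside e∈)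
          }
        ; c∈trail       = ∈-++⁺ˡ E₁.c∈trail
        ; label-c       = trans (E₂.label-outside λ (_ , ¬k₁c) → ¬k₁c ε) E₁.label-c
        ; corners-chain = c ∷ subst (λ y → Chain (rotation E₂.after) y (d ∷ ds) z)
            (sym (trans (unchanged ε) (after-c E₁.corners-chain))) E₂.corners-chain
        -- `cut (c ∷ d ∷ ds) τ` unfolds to `cut (d ∷ ds) τ₁`, as in the second exploration; for the
        -- first branch, these later cuts are invisible on `K₁`.
        ; reads         = λ σ≡ ℓ≡ →
              trans (All.head (E₁.reads (λ k₁x → trans (σ≡ (K₁⇒K k₁x)) (unchanged k₁x))
                                         (λ k₁x → trans (ℓ≡ (K₁⇒K k₁x)) (E₂.label-outside λ (_ , ¬k₁) → ¬k₁ k₁x))))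
                     (sym (branch-agree K₁-α k later-cuts ε)) ∷
              E₂.reads (σ≡ ∘ proj₁) (ℓ≡ ∘ proj₁)
        }
        where
        unchanged : ∀ {x} → K₁ x → rotation E₂.after x ≡ rotation E₁.after x
        unchanged k₁x = E₂.rotation-outside λ (_ , ¬k₁) → ¬k₁ k₁x
        after-c : ∀ {f : Dart n → Dart n} {d} → Chain f c (c ∷ []) d → f c ≡ d
        after-c (c ∷ []) = refl
        later-cuts : Agree K₁ (cut (d ∷ ds) τ₁) τ₁
        later-cuts = agree-cut-outside (d ∷ ds)
          (subst (All (λ a → ¬ K₁ a)) corners₂ (All.tabulate λ x∈ →
            near-d (vertex⇒conn (proj₁ (∈-filter⁻ (_∈? face τ₁ d) {xs = orbit τ₁ d} x∈)))))
          record { closed = λ k₁x → k₁x ◅◅ conn-σ ; agrees = λ _ → refl }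

-- An induction on the remaining outer corners. K shrinks, but es and k stay the same: all siblings
-- get the same fuel.
explore-along : ∀ {n} (g : Dart n) {k} → (∀ j → k ≡ suc j → Explorable g j) →
                ∀ {K τ s c z} ds es → Site g K τ s c z → (∀ {x} → K x → edge x ∈ es) →
                length es ≤ suc k → outerCorners τ c ≡ c ∷ ds → Explored g K τ s c z k (c ∷ ds)
explore-along g smaller []       es site es⊇ es≤ corners = explore-one g es site es⊇ es≤ smaller corners
explore-along g smaller (d ∷ ds) es site es⊇ es≤ corners = S.explored e₁ e₂
  where
  split = split-corner (Site.planar site) corners
  module S = Successive g site split
  e₁ = explore-one g es S.site₁ (es⊇ ∘ S.K₁⇒K) es≤ smaller (CornerSplit.corners₁ split)
  e₂ = explore-along g smaller ds es (S.site₂ e₁) (es⊇ ∘ proj₁) es≤ (CornerSplit.corners₂ split)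

explore : ∀ {n} (g : Dart n) k → Explorable g k
explore g k {K} {τ} {s} {c} {z} cs es site es⊇ es≤ corners
  with outerCorners-head (Planar.injective (Site.planar site)) c
... | t , eq = subst (Explored g K τ s c z k) (trans (sym eq) corners)
  (explore-along g (smaller k) (filter (_∈? face τ c) t) es site es⊇ es≤ eq)
  where
  smaller : ∀ k → (∀ j → k ≡ suc j → Explorable g j)
  smaller (suc k) .k refl = explore g k

-- The walk around the whole map

module _ {n : ℕ} {σ : Rotation n} (planar : Planar σ) (c : Dart n) where

  private
    s₀ : State n
    s₀ = record
      { rotation = σ
      ; label    = setLabel σ c (outv (rooted σ (just c))) (const 0)
      ; visited  = []
      ; position = c
      }

    everything : Dart n → Set
    everything _ = ⊤

    -- Nothing lies outside: z is c, the swap is trivial and the rest of the face is empty.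
    site : Site c everything σ s₀ c c
    site = record
      { K-α = λ _ → tt ; K-τ = λ _ → tt ; K-c = tt ; K-z = λ _ → refl
      ; planar = planar ; injective = Planar.injective planar
      ; rotation-on = λ _ → sym (swap-same c _)
      ; at = refl ; unvisited = λ _ ()
      ; rest = [] ; rest-chain = [] ; rest-outside = λ () ; g∈ = here refl
      }

  module _ {k} (explored : Explored c everything σ s₀ c c k (outerCorners σ c)) where
    open Explored explored

    private
      cs : List (Dart n)
      cs = outerCorners σ c

    walk-after : rotation (walk σ c) ≡ rotation after × label (walk σ c) ≡ label after
    walk-after with m≤n⇒∃[o]m+o≡n (unique-darts-length trail-unique)
    ... | m , eq = subst (λ s → rotation s ≡ rotation after × label s ≡ label after)
      (trans (cong (steps c m) (sym steps-after))
        (trans (sym (steps-+ c (length trail) m s₀)) (cong (λ N → steps c N s₀) eq)))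
      (settled trail-chain c∈trail trail-visited)
      where
      settled : ∀ {ws} → Chain (next (rotation after)) c ws c → c ∈ ws →
                (∀ {x} → x ∈ ws → edge x ∈ visited after) →
                rotation (steps c m after) ≡ rotation after × label (steps c m after) ≡ label after
      settled {w ∷ ws} ch c∈ vis with chain-head ch
      ... | refl = idle c m after ch (subst (_∈ c ∷ ws) (sym position-after) (here refl)) (All.tabulate vis)

    orbit-after : orbit (rotation after) c ≡ cs
    orbit-after with outerCorners-head (Planar.injective planar) c
    ... | t , eq = trans (cycle⇒orbit (subst (λ l → Chain (rotation after) c l c) eq corners-chain)
                                           (subst Unique eq (outerCorners-unique (Planar.injective planar) c))) (sym eq)

    label-root : label after c ≡ outv (rooted σ (just c))
    label-root = trans label-c (setLabel-on {σ = σ} {v = c} {ℓ = const 0} (here refl))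

    ρ-rec≡readTree : ρ-rec (suc k) (rooted σ (just c)) ≡
                     readTree (rotation (walk σ c)) (label (walk σ c)) (suc k) (label (walk σ c) c)
                              (orbit (rotation (walk σ c)) c)
    ρ-rec≡readTree = begin
      ρ-rec (suc k) (rooted σ (just c))
        ≡⟨ ρ-rec-unfold k σ c ⟩
      node (outv (rooted σ (just c))) (map (branch k (cut cs σ)) (reverse cs))
        ≡⟨ cong₂ node (sym label-root) (map-cong-local (All-reverse (All.map sym (reads (λ _ → refl) (λ _ → refl))))) ⟩
      readTree (rotation after) (label after) (suc k) (label after c) cs
        ≡⟨ cong (readTree (rotation after) (label after) (suc k) (label after c)) orbit-after ⟨
      readTree (rotation after) (label after) (suc k) (label after c) (orbit (rotation after) c)
        ≡⟨ cong₂ (λ τ ℓ → readTree τ ℓ (suc k) (ℓ c) (orbit τ c)) (proj₁ walk-after) (proj₂ walk-after) ⟨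
      readTree (rotation (walk σ c)) (label (walk σ c)) (suc k) (label (walk σ c) c)
               (orbit (rotation (walk σ c)) c) ∎
      where open ≡-Reasoning

  ρ-rec≡ρ′-rooted : ρ-rec n (rooted σ (just c)) ≡ ρ′-rooted (rooted σ (just c))
  ρ-rec≡ρ′-rooted = trans (cong (λ m → ρ-rec m (rooted σ (just c))) n≡)
    (trans (ρ-rec≡readTree explored)
           (cong (λ m → readTree (rotation (walk σ c)) (label (walk σ c)) m (label (walk σ c) c)
                                 (orbit (rotation (walk σ c)) c)) (sym n≡)))
    where
    -- The root dart provides an edge, so n is a successor and its predecessor is the fuel of the
    -- branches.
    nonempty : ∀ {m} → Fin m → ∃[ k ] m ≡ suc k
    nonempty {suc k} _ = k , refl
    k = proj₁ (nonempty (edge c))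
    n≡ = proj₂ (nonempty (edge c))
    explored : Explored c everything σ s₀ c c k (outerCorners σ c)
    explored = explore c k (outerCorners σ c) (allFin n) site (λ _ → ∈-allFin _)
                 (≤-reflexive (trans (length-tabulate {n = n} id) n≡)) refl

theorem5 : (n : ℕ) (M : RootedPlanarMap n) → ρ M ≡ ρ′ M
theorem5 _ vertexMap                   = refl
theorem5 _ (planarMap σ c conn genus) =
  ρ-rec≡ρ′-rooted (planar-map c (Injection.injective (↔⇒↣ σ)) conn genus) c
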